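{- The logic $\mathsf L(\mathfrak C_5)$ has finitary unification.
   Context: A frame is a finite poset with a least element; $\mathsf L(\mathfrak F)$ is the set of intuitionistic formulas valid in all Kripke models over $\mathfrak F$. $\mathfrak C_5$ is the six-element frame with elements $r,a,b,c,t,d$ where $r<a$, $r<b$, $a<c$, $a<t$, $b<t$, $b<d$ (and the relations following by transitivity), $c,t,d$ maximal, and no other relations. For an intermediate logic $\mathsf L$, a substitution $\sigma$ is an $\mathsf L$-unifier of $A$ if $\sigma(A)\in\mathsf L$; $\varepsilon\preccurlyeq\mu$ iff $\alpha\circ\varepsilon=_{\mathsf L}\mu$ for some substitution $\alpha$; a set $\Sigma$ of unifiers of $A$ is complete if each unifier of $A$ is $\succcurlyeq$ some member of $\Sigma$. Unification is finitary if it is not unitary (some unifiable formula has no single-element complete set) and every unifiable formula has a finite complete set of unifiers. -}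

module Defs where

open import Data.Nat using (ℕ)
open import Data.Bool using (Bool; true; false)
open import Data.Product using (Σ; _×_; _,_; ∃)
open import Data.Empty using (⊥)
open import Data.Unit using (⊤)
open import Data.Sum using (_⊎_)
open import Data.List using (List; _∷_; [])
open import Data.List.Relation.Unary.All using (All)
open import Data.List.Relation.Unary.Any using (Any)
open import Relation.Binary.PropositionalEquality using (_≡_)
open import Relation.Nullary using (¬_)

infixr 4 _⇒_
infixr 5 _∨'_
infixr 6 _∧'_

data Fm : Set where
  var  : ℕ → Fm
  ⊥'   : Fm
  _∧'_ : Fm → Fm → Fm
  _∨'_ : Fm → Fm → Fm
  _⇒_  : Fm → Fm → Fm

-- Frames (finite posets with least element) and Kripke semantics.
-- A frame is given by a carrier and a Bool-valued partial order.

record Frame : Set₁ where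
  field
    W   : Set
    _≤_ : W → W → Bool

module Semantics (F : Frame) where
  open Frame F

  record Valuation : Set where
    field
      val  : ℕ → W → Bool
      mono : ∀ p x y → x ≤ y ≡ true → val p x ≡ true → val p y ≡ true

  open Valuation

  _,_⊩_ : Valuation → W → Fm → Set
  V , x ⊩ var p   = val V p x ≡ true
  V , x ⊩ ⊥'      = ⊥
  V , x ⊩ (A ∧' B) = (V , x ⊩ A) × (V , x ⊩ B)
  V , x ⊩ (A ∨' B) = (V , x ⊩ A) ⊎ (V , x ⊩ B)
  V , x ⊩ (A ⇒ B)  = ∀ y → x ≤ y ≡ true → V , y ⊩ A → V , y ⊩ B

  InL : Fm → Set
  InL A = ∀ (V : Valuation) (x : W) → V , x ⊩ A

-- The frame C5: r<a, r<b, a<c, a<t, b<t, b<d (with transitive closure)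

data C5W : Set where
  r a b c t d : C5W

_≤C5_ : C5W → C5W → Bool
r ≤C5 _ = true
a ≤C5 a = true
a ≤C5 c = true
a ≤C5 t = true
b ≤C5 b = true
b ≤C5 t = true
b ≤C5 d = true
c ≤C5 c = true
t ≤C5 t = true
d ≤C5 d = true
_ ≤C5 _ = false

C5 : Frame
C5 = record { W = C5W ; _≤_ = _≤C5_ }

Subst : Set
Subst = ℕ → Fm

_[_] : Fm → Subst → Fm
var p [ σ ]    = σ p
⊥' [ σ ]       = ⊥'
(A ∧' B) [ σ ] = (A [ σ ]) ∧' (B [ σ ])
(A ∨' B) [ σ ] = (A [ σ ]) ∨' (B [ σ ])
(A ⇒ B) [ σ ]  = (A [ σ ]) ⇒ (B [ σ ])

_∘ˢ_ : Subst → Subst → Subst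
(α ∘ˢ ε) p = (ε p) [ α ]

module Unification (L : Fm → Set) where

  Unifier : Fm → Subst → Set
  Unifier A σ = L (A [ σ ])

  Unifiable : Fm → Set
  Unifiable A = Σ Subst (Unifier A)

  _=L_ : Subst → Subst → Set
  σ =L μ = ∀ p → L ((σ p ⇒ μ p) ∧' (μ p ⇒ σ p))

  _≼_ : Subst → Subst → Set
  ε ≼ μ = Σ Subst (λ α → (α ∘ˢ ε) =L μ)

  Complete : Fm → List Subst → Set
  Complete A Σs = All (Unifier A) Σs
                × (∀ μ → Unifier A μ → Any (λ ε → ε ≼ μ) Σs)

  Unitary : Set
  Unitary = ∀ A → Unifiable A → Σ Subst (λ σ → Complete A (σ ∷ []))

  Finitary : Set
  Finitary = (Σ Fm (λ A → Unifiable A × ¬ Σ Subst (λ σ → Complete A (σ ∷ []))))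
           × (∀ A → Unifiable A → Σ (List Subst) (Complete A))

L-C5 : Fm → Set
L-C5 = Semantics.InL C5

{-# OPTIONS --safe #-}
module Submission where

-- Let A have variables below n. A unifier μ of A sends models in k variables on C5 to models of A,
-- and these are described by the finite family of values at the maximal points of C5, each taken
-- together with the forks (values at a or b) in which it occurs; the number of such types depends
-- on n only. As the type of t records all forks it lies on, any two forks of the family with a
-- common point t can be completed at the root to a model of A. With one new variable for each
-- type, the family is therefore axiomatised by a formula B which implies A and has Ghilardi's
-- extension property, so that B has a projective unifier; its restriction to the variables of A is
-- a unifier of A, and it is more general than μ since μ extends to a unifier of B. There are
-- finitely many families, hence finitely many such unifiers.

open import Defs
open import Data.Bool using (Bool; true; false; not; if_then_else_)
  renaming (_∧_ to _&_; _∨_ to _∥_)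
import Data.Bool.Properties as Bool
open import Data.Empty using (⊥; ⊥-elim)
open import Data.Fin using (Fin; zero; suc; toℕ)
import Data.Fin.Properties as Fin
open import Data.List
  using (List; []; _∷_; _++_; map; allFin; length; lookup; filter; cartesianProduct)
open import Data.List.Membership.Propositional using (_∈_; lose)
open import Data.List.Membership.Propositional.Properties
  using (∈-map⁺; ∈-++⁺ˡ; ∈-++⁺ʳ; ∈-allFin; ∈-filter⁺; ∈-filter⁻; ∈-cartesianProduct⁺; ∈-lookup)
import Data.List.Membership.DecPropositional as DecMembership
import Data.List.Properties as List
open import Data.List.Relation.Unary.All as All using (All; []; _∷_)
open import Data.List.Relation.Unary.Any as Any using (Any; here; there)
open import Data.List.Relation.Unary.Any.Properties using (lookup-index)
open import Data.Nat using (ℕ; zero; suc; _+_; _<_; _≤_; _⊔_; z≤n; s≤s)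
import Data.Nat.Properties as ℕ
open import Data.Product using (Σ; ∃; _×_; _,_; proj₁; proj₂)
import Data.Product.Properties as Product
open import Data.Sum using (_⊎_; inj₁; inj₂; [_,_]′)
open import Data.Unit using (⊤; tt)
open import Data.Vec using (Vec; []; _∷_)
import Data.Vec.Properties as Vec
open import Function using (_∘_; id; _⇔_; mk⇔)
open import Function.Bundles using (module Equivalence)
open import Relation.Binary.Definitions using (DecidableEquality)
open import Relation.Binary.PropositionalEquality
  using (_≡_; _≢_; refl; sym; trans; cong; cong₂; subst)
open import Relation.Nullary using (¬_; Dec; yes; no; does)
open import Relation.Nullary.Decidable using (map′; dec-true; _×-dec_; _→-dec_)

open Equivalence using (to; from)
open Semantics C5 renaming (_,_⊩_ to _at_⊩_)
open Valuation
open Unification L-C5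

-- The obstacle is gluing at `t`. Two assignments to which `μ` gives the same value may lie on
-- different forks, so values alone do not tell which pairs of forks can share `t`; this is why the
-- types, and with them the new variables, are needed. On the other hand the forks of C5 form a path
-- from `c` over `t` to `d`, and `c` and `d` lie on one fork each. A type can therefore record the
-- other end of a fork by its value alone and not by its type, which stops the recording after one
-- step instead of nesting it. The price is that a fork counted as admissible between two types need
-- not be realised by `μ` between representatives of both; each type only has to realise it from its
-- own side, and this suffices because `A` is evaluated on values. The finite list of unifiers is
-- computed without reference to any `μ`: every family that passes a decidable amalgamation test
-- yields a unifier of `A`, and the families that come from unifiers are among those that pass.

infixr 5 _⊃_

_⊃_ : Bool → Bool → Bool
x ⊃ y = not x ∥ y

&-intro : ∀ {x y} → x ≡ true → y ≡ true → x & y ≡ true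
&-intro refl refl = refl

&-elim : ∀ {x y} → x & y ≡ true → x ≡ true × y ≡ true
&-elim {true} {true} refl = refl , refl

∥-introˡ : ∀ {x y} → x ≡ true → x ∥ y ≡ true
∥-introˡ refl = refl

∥-introʳ : ∀ {x y} → y ≡ true → x ∥ y ≡ true
∥-introʳ {false} refl = refl
∥-introʳ {true}  refl = refl

∥-elim : ∀ {x y} → x ∥ y ≡ true → x ≡ true ⊎ y ≡ true
∥-elim {true}  e = inj₁ refl
∥-elim {false} e = inj₂ e

⊃-intro : ∀ {x y} → (x ≡ true → y ≡ true) → x ⊃ y ≡ true
⊃-intro {false} f = refl
⊃-intro {true}  f = f refl

⊃-elim : ∀ {x y} → x ⊃ y ≡ true → x ≡ true → y ≡ true
⊃-elim e refl = e

⇔→≡ : ∀ {x y : Bool} → (x ≡ true → y ≡ true) → (y ≡ true → x ≡ true) → x ≡ y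
⇔→≡ {true}          f g = sym (f refl)
⇔→≡ {false} {true}  f g = g refl
⇔→≡ {false} {false} f g = refl

-- Removes the intersection with the values above in the variable clauses of `fork` and `root` once
-- persistence is known.
&-absorb : ∀ {x y z} → (x ≡ true → y ≡ true × z ≡ true) → x & (y & z) ≡ x
&-absorb {false} f = refl
&-absorb {true}  f with f refl
... | refl , refl = refl

-- Boolean evaluation of formulas on C5.

Assignment : Set
Assignment = ℕ → Bool

-- The variable clauses of fork and root intersect with the values above, so that every choice of
-- assignments is a model and no monotonicity has to be assumed.

top : Assignment → Fm → Bool
top u (var p)  = u p
top u ⊥'       = false
top u (A ∧' B) = top u A & top u B
top u (A ∨' B) = top u A ∥ top u B
top u (A ⇒ B)  = top u A ⊃ top u B

fork : Assignment → Assignment → Assignment → Fm → Bool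
fork u v w (var p)  = w p & (u p & v p)
fork u v w ⊥'       = false
fork u v w (A ∧' B) = fork u v w A & fork u v w B
fork u v w (A ∨' B) = fork u v w A ∥ fork u v w B
fork u v w (A ⇒ B)  = (fork u v w A ⊃ fork u v w B) & (top u (A ⇒ B) & top v (A ⇒ B))

Model : Set
Model = C5W → Assignment

evA evB root : Model → Fm → Bool
evA M = fork (M c) (M t) (M a)
evB M = fork (M t) (M d) (M b)
root M (var p)  = M r p & (evA M (var p) & evB M (var p))
root M ⊥'       = false
root M (A ∧' B) = root M A & root M B
root M (A ∨' B) = root M A ∥ root M B
root M (A ⇒ B)  = (root M A ⊃ root M B) & (evA M (A ⇒ B) & evB M (A ⇒ B))

ev : Model → C5W → Fm → Bool
ev M r = root M
ev M a = evA M
ev M b = evB M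
ev M c = top (M c)
ev M t = top (M t)
ev M d = top (M d)

fork-persistent : ∀ {u v w} A → fork u v w A ≡ true → top u A ≡ true × top v A ≡ true
fork-persistent {w = w} (var p) e = &-elim (proj₂ (&-elim {w p} e))
fork-persistent (A ∧' B) e with &-elim e
... | eA , eB with fork-persistent A eA | fork-persistent B eB
... | uA , vA | uB , vB = &-intro uA uB , &-intro vA vB
fork-persistent {u} {v} (A ∨' B) e with ∥-elim e
... | inj₁ eA = let uA , vA = fork-persistent A eA in ∥-introˡ uA , ∥-introˡ vA
... | inj₂ eB = let uB , vB = fork-persistent B eB in
  ∥-introʳ {top u A} uB , ∥-introʳ {top v A} vB
fork-persistent {u} {v} {w} (A ⇒ B) e =
  &-elim (proj₂ (&-elim {fork u v w A ⊃ fork u v w B} e))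

root-persistent : ∀ {M} A → root M A ≡ true → evA M A ≡ true × evB M A ≡ true
root-persistent {M} (var p) e = &-elim (proj₂ (&-elim {M r p} e))
root-persistent (A ∧' B) e with &-elim e
... | eA , eB with root-persistent A eA | root-persistent B eB
... | aA , bA | aB , bB = &-intro aA aB , &-intro bA bB
root-persistent {M} (A ∨' B) e with ∥-elim e
... | inj₁ eA = let aA , bA = root-persistent A eA in ∥-introˡ aA , ∥-introˡ bA
... | inj₂ eB = let aB , bB = root-persistent B eB in
  ∥-introʳ {evA M A} aB , ∥-introʳ {evB M A} bB
root-persistent {M} (A ⇒ B) e = &-elim (proj₂ (&-elim {root M A ⊃ root M B} e))

top-subst : ∀ {u} σ A → top u (A [ σ ]) ≡ top (top u ∘ σ) A
top-subst σ (var p)  = refl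
top-subst σ ⊥'       = refl
top-subst σ (A ∧' B) = cong₂ _&_ (top-subst σ A) (top-subst σ B)
top-subst σ (A ∨' B) = cong₂ _∥_ (top-subst σ A) (top-subst σ B)
top-subst σ (A ⇒ B)  = cong₂ _⊃_ (top-subst σ A) (top-subst σ B)

fork-subst : ∀ {u v w} σ A →
  fork u v w (A [ σ ]) ≡ fork (top u ∘ σ) (top v ∘ σ) (fork u v w ∘ σ) A
fork-subst σ (var p)  = sym (&-absorb (fork-persistent (σ p)))
fork-subst σ ⊥'       = refl
fork-subst σ (A ∧' B) = cong₂ _&_ (fork-subst σ A) (fork-subst σ B)
fork-subst σ (A ∨' B) = cong₂ _∥_ (fork-subst σ A) (fork-subst σ B)
fork-subst σ (A ⇒ B)  = cong₂ _&_ (cong₂ _⊃_ (fork-subst σ A) (fork-subst σ B))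
  (cong₂ _&_ (top-subst σ (A ⇒ B)) (top-subst σ (A ⇒ B)))

pull : Subst → Model → Model
pull σ M x p = ev M x (σ p)

root-subst : ∀ {M} σ A → root M (A [ σ ]) ≡ root (pull σ M) A
root-subst {M} σ (var p)  = sym (trans
  (cong (root M (σ p) &_) (cong₂ _&_ (sym (fork-subst σ (var p))) (sym (fork-subst σ (var p)))))
  (&-absorb (root-persistent (σ p))))
root-subst σ ⊥'       = refl
root-subst σ (A ∧' B) = cong₂ _&_ (root-subst σ A) (root-subst σ B)
root-subst σ (A ∨' B) = cong₂ _∥_ (root-subst σ A) (root-subst σ B)
root-subst σ (A ⇒ B)  = cong₂ _&_ (cong₂ _⊃_ (root-subst σ A) (root-subst σ B))
  (cong₂ _&_ (fork-subst σ (A ⇒ B)) (fork-subst σ (A ⇒ B)))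

ev-subst : ∀ M x σ A → ev M x (A [ σ ]) ≡ ev (pull σ M) x A
ev-subst M r = root-subst
ev-subst M a = fork-subst
ev-subst M b = fork-subst
ev-subst M c = top-subst
ev-subst M t = top-subst
ev-subst M d = top-subst

fork-comm : ∀ u v w A → fork u v w A ≡ fork v u w A
fork-comm u v w (var p)  = cong (w p &_) (Bool.∧-comm (u p) (v p))
fork-comm u v w ⊥'       = refl
fork-comm u v w (A ∧' B) = cong₂ _&_ (fork-comm u v w A) (fork-comm u v w B)
fork-comm u v w (A ∨' B) = cong₂ _∥_ (fork-comm u v w A) (fork-comm u v w B)
fork-comm u v w (A ⇒ B)  = cong₂ _&_ (cong₂ _⊃_ (fork-comm u v w A) (fork-comm u v w B))
  (Bool.∧-comm (top u (A ⇒ B)) (top v (A ⇒ B)))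

&-idem₃ : ∀ x → x & (x & x) ≡ x
&-idem₃ false = refl
&-idem₃ true  = refl

fork-const : ∀ u A → fork u u u A ≡ top u A
fork-const u (var p)  = &-idem₃ (u p)
fork-const u ⊥'       = refl
fork-const u (A ∧' B) = cong₂ _&_ (fork-const u A) (fork-const u B)
fork-const u (A ∨' B) = cong₂ _∥_ (fork-const u A) (fork-const u B)
fork-const u (A ⇒ B)  = trans
  (cong (_& (top u (A ⇒ B) & top u (A ⇒ B))) (cong₂ _⊃_ (fork-const u A) (fork-const u B)))
  (&-idem₃ _)

model : (uc ut ud ua ub ur : Assignment) → Model
model uc ut ud ua ub ur c = uc
model uc ut ud ua ub ur t = ut
model uc ut ud ua ub ur d = ud
model uc ut ud ua ub ur a = ua
model uc ut ud ua ub ur b = ub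
model uc ut ud ua ub ur r = ur

-- Both models are bisimilar to a two-element chain: all points above the bottom carry `u` and can
-- be identified.
root-const : ∀ u w A → root (model u u u u u w) A ≡ fork u u w A
root-const u w (var p)  = cong (w p &_) (cong₂ _&_ (&-idem₃ (u p)) (&-idem₃ (u p)))
root-const u w ⊥'       = refl
root-const u w (A ∧' B) = cong₂ _&_ (root-const u w A) (root-const u w B)
root-const u w (A ∨' B) = cong₂ _∥_ (root-const u w A) (root-const u w B)
root-const u w (A ⇒ B)  = cong₂ _&_ (cong₂ _⊃_ (root-const u w A) (root-const u w B))
  (cong₂ _&_ (fork-const u (A ⇒ B)) (fork-const u (A ⇒ B)))

-- Dependence on finitely many variables.

VarsBelow : ℕ → Fm → Set
VarsBelow n (var p)  = p < n
VarsBelow n ⊥'       = ⊤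
VarsBelow n (A ∧' B) = VarsBelow n A × VarsBelow n B
VarsBelow n (A ∨' B) = VarsBelow n A × VarsBelow n B
VarsBelow n (A ⇒ B)  = VarsBelow n A × VarsBelow n B

varsBelow-mono : ∀ {m n} → m ≤ n → ∀ A → VarsBelow m A → VarsBelow n A
varsBelow-mono le (var p)  h       = ℕ.≤-trans h le
varsBelow-mono le ⊥'       h       = tt
varsBelow-mono le (A ∧' B) (h , k) = varsBelow-mono le A h , varsBelow-mono le B k
varsBelow-mono le (A ∨' B) (h , k) = varsBelow-mono le A h , varsBelow-mono le B k
varsBelow-mono le (A ⇒ B)  (h , k) = varsBelow-mono le A h , varsBelow-mono le B k

⊔-below : ∀ m n A B → VarsBelow m A → VarsBelow n B →
  VarsBelow (m ⊔ n) A × VarsBelow (m ⊔ n) B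
⊔-below m n A B h k =
  varsBelow-mono (ℕ.m≤m⊔n m n) A h , varsBelow-mono (ℕ.m≤n⊔m m n) B k

bounded : ∀ A → ∃ λ n → VarsBelow n A
bounded (var p)  = suc p , ℕ.≤-refl
bounded ⊥'       = 0 , tt
bounded (A ∧' B) with bounded A | bounded B
... | m , h | n , k = m ⊔ n , ⊔-below m n A B h k
bounded (A ∨' B) with bounded A | bounded B
... | m , h | n , k = m ⊔ n , ⊔-below m n A B h k
bounded (A ⇒ B) with bounded A | bounded B
... | m , h | n , k = m ⊔ n , ⊔-below m n A B h k

Agree : ℕ → Assignment → Assignment → Set
Agree n u v = ∀ p → p < n → u p ≡ v p

top-local : ∀ {n u u'} → Agree n u u' → ∀ A → VarsBelow n A → top u A ≡ top u' A
top-local e (var p)  h       = e p h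
top-local e ⊥'       h       = refl
top-local e (A ∧' B) (h , k) = cong₂ _&_ (top-local e A h) (top-local e B k)
top-local e (A ∨' B) (h , k) = cong₂ _∥_ (top-local e A h) (top-local e B k)
top-local e (A ⇒ B)  (h , k) = cong₂ _⊃_ (top-local e A h) (top-local e B k)

fork-local : ∀ {n u u' v v' w w'} → Agree n u u' → Agree n v v' → Agree n w w' →
  ∀ A → VarsBelow n A → fork u v w A ≡ fork u' v' w' A
fork-local e f g (var p)  h       = cong₂ _&_ (g p h) (cong₂ _&_ (e p h) (f p h))
fork-local e f g ⊥'       h       = refl
fork-local e f g (A ∧' B) (h , k) = cong₂ _&_ (fork-local e f g A h) (fork-local e f g B k)
fork-local e f g (A ∨' B) (h , k) = cong₂ _∥_ (fork-local e f g A h) (fork-local e f g B k)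
fork-local e f g (A ⇒ B)  (h , k) =
  cong₂ _&_ (cong₂ _⊃_ (fork-local e f g A h) (fork-local e f g B k))
    (cong₂ _&_ (top-local e (A ⇒ B) (h , k)) (top-local f (A ⇒ B) (h , k)))

root-local : ∀ {n M M'} → (∀ x → Agree n (M x) (M' x)) →
  ∀ A → VarsBelow n A → root M A ≡ root M' A
root-local e (var p)  h       = cong₂ _&_ (e r p h) (cong₂ _&_
  (fork-local (e c) (e t) (e a) (var p) h) (fork-local (e t) (e d) (e b) (var p) h))
root-local e ⊥'       h       = refl
root-local e (A ∧' B) (h , k) = cong₂ _&_ (root-local e A h) (root-local e B k)
root-local e (A ∨' B) (h , k) = cong₂ _∥_ (root-local e A h) (root-local e B k)
root-local e (A ⇒ B)  (h , k) =
  cong₂ _&_ (cong₂ _⊃_ (root-local e A h) (root-local e B k))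
    (cong₂ _&_ (fork-local (e c) (e t) (e a) (A ⇒ B) (h , k))
               (fork-local (e t) (e d) (e b) (A ⇒ B) (h , k)))

-- Kripke forcing on C5

≤-refl : ∀ x → x ≤C5 x ≡ true
≤-refl r = refl
≤-refl a = refl
≤-refl b = refl
≤-refl c = refl
≤-refl t = refl
≤-refl d = refl

≥a-elim : (P : C5W → Set) → P a → P c → P t → ∀ y → a ≤C5 y ≡ true → P y
≥a-elim P pa pc pt a _ = pa
≥a-elim P pa pc pt c _ = pc
≥a-elim P pa pc pt t _ = pt

≥b-elim : (P : C5W → Set) → P b → P t → P d → ∀ y → b ≤C5 y ≡ true → P y
≥b-elim P pb pt pd b _ = pb
≥b-elim P pb pt pd t _ = pt
≥b-elim P pb pt pd d _ = pd

data Maximal : C5W → Set where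
  c-max : Maximal c
  t-max : Maximal t
  d-max : Maximal d

maximal-elim : ∀ {x} → Maximal x → (P : C5W → Set) → P x → ∀ y → x ≤C5 y ≡ true → P y
maximal-elim c-max P p c _ = p
maximal-elim t-max P p t _ = p
maximal-elim d-max P p d _ = p

≤-trans : ∀ x y z → x ≤C5 y ≡ true → y ≤C5 z ≡ true → x ≤C5 z ≡ true
≤-trans r y z _ _ = refl
≤-trans a y z h k = ≥a-elim (λ y → ∀ z → y ≤C5 z ≡ true → a ≤C5 z ≡ true)
  (λ _ e → e) (maximal-elim c-max _ refl) (maximal-elim t-max _ refl) y h z k
≤-trans b y z h k = ≥b-elim (λ y → ∀ z → y ≤C5 z ≡ true → b ≤C5 z ≡ true)
  (λ _ e → e) (maximal-elim t-max _ refl) (maximal-elim d-max _ refl) y h z k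
≤-trans c y z h k = maximal-elim c-max (λ y → y ≤C5 z ≡ true → c ≤C5 z ≡ true) id y h k
≤-trans t y z h k = maximal-elim t-max (λ y → y ≤C5 z ≡ true → t ≤C5 z ≡ true) id y h k
≤-trans d y z h k = maximal-elim d-max (λ y → y ≤C5 z ≡ true → d ≤C5 z ≡ true) id y h k

⊩-mono : ∀ V A {x y} → x ≤C5 y ≡ true → V at x ⊩ A → V at y ⊩ A
⊩-mono V (var p)  x≤y h        = mono V p _ _ x≤y h
⊩-mono V (A ∧' B) x≤y (h , k)  = ⊩-mono V A x≤y h , ⊩-mono V B x≤y k
⊩-mono V (A ∨' B) x≤y (inj₁ h) = inj₁ (⊩-mono V A x≤y h)
⊩-mono V (A ∨' B) x≤y (inj₂ h) = inj₂ (⊩-mono V B x≤y h)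
⊩-mono V (A ⇒ B)  x≤y h z y≤z  = h z (≤-trans _ _ z x≤y y≤z)

ev-⇒ : ∀ M x A B → ev M x (A ⇒ B) ≡ true ⇔
  (∀ y → x ≤C5 y ≡ true → ev M y A ≡ true → ev M y B ≡ true)
ev-⇒ M x A B = mk⇔ (elim x) (intro x)
  where
  Imp : C5W → Set
  Imp y = ev M y A ≡ true → ev M y B ≡ true
  elim-a : evA M (A ⇒ B) ≡ true → Imp a × Imp c × Imp t
  elim-a e with &-elim e
  ... | ea , ect with &-elim ect
  ... | ec , et = ⊃-elim ea , ⊃-elim ec , ⊃-elim et
  elim-b : evB M (A ⇒ B) ≡ true → Imp b × Imp t × Imp d
  elim-b e with &-elim e
  ... | eb , etd with &-elim etd
  ... | et , ed = ⊃-elim eb , ⊃-elim et , ⊃-elim ed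
  elim : ∀ x → ev M x (A ⇒ B) ≡ true → ∀ y → x ≤C5 y ≡ true → Imp y
  elim r e y _ with &-elim e
  ... | er , eab with &-elim eab
  ... | ea , eb = go y
    where
    go : ∀ y → Imp y
    go r = ⊃-elim er
    go a = proj₁ (elim-a ea)
    go c = proj₁ (proj₂ (elim-a ea))
    go t = proj₂ (proj₂ (elim-a ea))
    go b = proj₁ (elim-b eb)
    go d = proj₂ (proj₂ (elim-b eb))
  elim a e = let ia , ic , it = elim-a e in ≥a-elim Imp ia ic it
  elim b e = let ib , it , id' = elim-b e in ≥b-elim Imp ib it id'
  elim c e = maximal-elim c-max Imp (⊃-elim e)
  elim t e = maximal-elim t-max Imp (⊃-elim e)
  elim d e = maximal-elim d-max Imp (⊃-elim e)
  intro : ∀ x → (∀ y → x ≤C5 y ≡ true → Imp y) → ev M x (A ⇒ B) ≡ true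
  intro c f = ⊃-intro (f c refl)
  intro t f = ⊃-intro (f t refl)
  intro d f = ⊃-intro (f d refl)
  intro a f = &-intro (⊃-intro (f a refl)) (&-intro (⊃-intro (f c refl)) (⊃-intro (f t refl)))
  intro b f = &-intro (⊃-intro (f b refl)) (&-intro (⊃-intro (f t refl)) (⊃-intro (f d refl)))
  intro r f = &-intro (⊃-intro (f r refl)) (&-intro
    (intro a (≥a-elim Imp (f a refl) (f c refl) (f t refl)))
    (intro b (≥b-elim Imp (f b refl) (f t refl) (f d refl))))

Represents : Model → Valuation → Set
Represents M V = ∀ p x → val V p x ≡ ev M x (var p)

⊩⇔ev : ∀ {M V} → Represents M V → ∀ A x → V at x ⊩ A ⇔ ev M x A ≡ true
⊩⇔ev {M} {V} h (var p) x =
  mk⇔ (trans (sym (h p x))) (trans (h p x))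
⊩⇔ev h ⊥' x = mk⇔ (λ ()) (bot x)
  where
  bot : ∀ {M} x → ev M x ⊥' ≡ true → ⊥
  bot r ()
  bot a ()
  bot b ()
  bot c ()
  bot t ()
  bot d ()
⊩⇔ev {M} h (A ∧' B) x = mk⇔
  (λ (α , β) → trans (ev-∧ x) (&-intro (to (⊩⇔ev h A x) α) (to (⊩⇔ev h B x) β)))
  (λ e → let α , β = &-elim (trans (sym (ev-∧ x)) e) in
     from (⊩⇔ev h A x) α , from (⊩⇔ev h B x) β)
  where
  ev-∧ : ∀ x → ev M x (A ∧' B) ≡ ev M x A & ev M x B
  ev-∧ r = refl
  ev-∧ a = refl
  ev-∧ b = refl
  ev-∧ c = refl
  ev-∧ t = refl
  ev-∧ d = refl
⊩⇔ev {M} h (A ∨' B) x = mk⇔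
  (λ { (inj₁ α) → trans (ev-∨ x) (∥-introˡ (to (⊩⇔ev h A x) α))
     ; (inj₂ β) → trans (ev-∨ x) (∥-introʳ {ev M x A} (to (⊩⇔ev h B x) β)) })
  (λ e → [ (λ α → inj₁ (from (⊩⇔ev h A x) α)) , (λ β → inj₂ (from (⊩⇔ev h B x) β)) ]′
     (∥-elim (trans (sym (ev-∨ x)) e)))
  where
  ev-∨ : ∀ x → ev M x (A ∨' B) ≡ ev M x A ∥ ev M x B
  ev-∨ r = refl
  ev-∨ a = refl
  ev-∨ b = refl
  ev-∨ c = refl
  ev-∨ t = refl
  ev-∨ d = refl
⊩⇔ev {M} h (A ⇒ B) x = mk⇔
  (λ f → from (ev-⇒ M x A B)
     λ y x≤y e → to (⊩⇔ev h B y) (f y x≤y (from (⊩⇔ev h A y) e)))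
  (λ e y x≤y α → from (⊩⇔ev h B y) (to (ev-⇒ M x A B) e y x≤y (to (⊩⇔ev h A y) α)))

modelOf : Valuation → Model
modelOf V x p = val V p x

modelOf-represents : ∀ V → Represents (modelOf V) V
modelOf-represents V p r = sym (&-absorb λ e →
  trans (sym (modelOf-represents V p a)) (mono V p r a refl e) ,
  trans (sym (modelOf-represents V p b)) (mono V p r b refl e))
modelOf-represents V p a = sym (&-absorb λ e → mono V p a c refl e , mono V p a t refl e)
modelOf-represents V p b = sym (&-absorb λ e → mono V p b t refl e , mono V p b d refl e)
modelOf-represents V p c = refl
modelOf-represents V p t = refl
modelOf-represents V p d = refl

⊩⇔evV : ∀ V A x → V at x ⊩ A ⇔ ev (modelOf V) x A ≡ true
⊩⇔evV V = ⊩⇔ev (modelOf-represents V)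

-- Forcing is equivalent to a Boolean computation; this keeps the later case distinctions on `B` and
-- on the marks constructive.
_at_⊩?_ : ∀ V x A → Dec (V at x ⊩ A)
V at x ⊩? A = map′ (from (⊩⇔evV V A x)) (to (⊩⇔evV V A x)) (ev (modelOf V) x A Bool.≟ true)

ev-mono : ∀ M A {x y} → x ≤C5 y ≡ true → ev M x A ≡ true → ev M y A ≡ true
ev-mono M A {r} {y} _ e with root-persistent A e
... | ea , eb with fork-persistent A ea | fork-persistent A eb
... | ec , et | _ , ed = go y
  where
  go : ∀ y → ev M y A ≡ true
  go r = e
  go a = ea
  go b = eb
  go c = ec
  go t = et
  go d = ed
ev-mono M A {a} {y} h e = let ec , et = fork-persistent A e in
  ≥a-elim (λ y → ev M y A ≡ true) e ec et y h
ev-mono M A {b} {y} h e = let et , ed = fork-persistent A e in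
  ≥b-elim (λ y → ev M y A ≡ true) e et ed y h
ev-mono M A {c} {y} h e = maximal-elim c-max (λ y → ev M y A ≡ true) e y h
ev-mono M A {t} {y} h e = maximal-elim t-max (λ y → ev M y A ≡ true) e y h
ev-mono M A {d} {y} h e = maximal-elim d-max (λ y → ev M y A ≡ true) e y h

valuation : Model → Valuation
valuation M = record { val = λ p x → ev M x (var p) ; mono = λ p x y → ev-mono M (var p) }

InL⇒ev : ∀ A → InL A → ∀ M x → ev M x A ≡ true
InL⇒ev A h M x = to (⊩⇔ev {M} {valuation M} (λ _ _ → refl) A x) (h (valuation M) x)

_⋆_ : Subst → Valuation → Valuation
σ ⋆ V = record
  { val  = λ p x → ev (modelOf V) x (σ p)
  ; mono = λ p x y → ev-mono (modelOf V) (σ p) }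

⋆-⊩ : ∀ σ V A x → (σ ⋆ V) at x ⊩ A ⇔ V at x ⊩ (A [ σ ])
⋆-⊩ σ V A x = mk⇔
  (λ h → from (⊩⇔evV V (A [ σ ]) x)
     (trans (ev-subst (modelOf V) x σ A) (to (⊩⇔evV (σ ⋆ V) A x) h)))
  (λ h → from (⊩⇔evV (σ ⋆ V) A x)
     (trans (sym (ev-subst (modelOf V) x σ A)) (to (⊩⇔evV V (A [ σ ]) x) h)))

AgreeAt : Valuation → Valuation → C5W → Set
AgreeAt V V' x = ∀ p → val V p x ≡ val V' p x

⊩-local : ∀ {V V'} A x → (∀ y → x ≤C5 y ≡ true → AgreeAt V V' y) → V at x ⊩ A → V' at x ⊩ A
⊩-local (var p)  x e h        = trans (sym (e x (≤-refl x) p)) h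
⊩-local (A ∧' B) x e (h , k)  = ⊩-local A x e h , ⊩-local B x e k
⊩-local (A ∨' B) x e (inj₁ h) = inj₁ (⊩-local A x e h)
⊩-local (A ∨' B) x e (inj₂ h) = inj₂ (⊩-local B x e h)
⊩-local {V} {V'} (A ⇒ B) x e h y x≤y k =
  ⊩-local B y e' (h y x≤y (⊩-local A y (λ z y≤z p → sym (e' z y≤z p)) k))
  where
  e' : ∀ z → y ≤C5 z ≡ true → AgreeAt V V' z
  e' z y≤z = e z (≤-trans x y z x≤y y≤z)

[]-var : ∀ A → A [ var ] ≡ A
[]-var (var p)  = refl
[]-var ⊥'       = refl
[]-var (A ∧' B) = cong₂ _∧'_ ([]-var A) ([]-var B)
[]-var (A ∨' B) = cong₂ _∨'_ ([]-var A) ([]-var B)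
[]-var (A ⇒ B)  = cong₂ _⇒_ ([]-var A) ([]-var B)

[]-∘ : ∀ τ σ A → A [ τ ∘ˢ σ ] ≡ (A [ σ ]) [ τ ]
[]-∘ τ σ (var p)  = refl
[]-∘ τ σ ⊥'       = refl
[]-∘ τ σ (A ∧' B) = cong₂ _∧'_ ([]-∘ τ σ A) ([]-∘ τ σ B)
[]-∘ τ σ (A ∨' B) = cong₂ _∨'_ ([]-∘ τ σ A) ([]-∘ τ σ B)
[]-∘ τ σ (A ⇒ B)  = cong₂ _⇒_ ([]-∘ τ σ A) ([]-∘ τ σ B)

-- Ghilardi's projective substitutions. At a point where B fails and above which B holds,
-- θ α replaces the valuation by α (intersected with the values above), and it changes nothing
-- where B holds. So applying every α of a list in turn repairs all such points as soon as some α
-- of the list can; three rounds suffice, one for each level of C5.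

module Projective (B : Fm) (αs : List Assignment) where

  θ : Assignment → Subst
  θ α p = if α p then (B ⇒ var p) else (B ∧' var p)

  -- Describes `θ α ⋆ V` at and above `x` by its values only. Since `Repairs` quantifies over all
  -- valuations of this description, a repair found for `V` can be carried over to valuations
  -- already altered by other assignments.
  Update : Valuation → Valuation → C5W → Assignment → Set
  Update V V' x α =
    (∀ y → x ≤C5 y ≡ true → V at y ⊩ B → AgreeAt V V' y) ×
    (∀ p → val V' p x ≡ true ⇔
      (α p ≡ true × (∀ y → x ≤C5 y ≡ true → V at y ⊩ B → val V p y ≡ true)))

  Repairs : Valuation → C5W → Assignment → Set
  Repairs V x α = ∀ V' → Update V V' x α → V' at x ⊩ B

  HoldsAbove : Valuation → C5W → Set
  HoldsAbove V x = ∀ y → x ≤C5 y ≡ true → y ≡ x ⊎ V at y ⊩ B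

  Extendable : Set
  Extendable = ∀ V x → ¬ (V at x ⊩ B) → HoldsAbove V x → Any (Repairs V x) αs

  θ-agree : ∀ α V x → V at x ⊩ B → AgreeAt V (θ α ⋆ V) x
  θ-agree α V x h p =
    ⇔→≡ (to (⊩⇔evV V (θ α p) x) ∘ intro (α p)) (elim (α p) ∘ from (⊩⇔evV V (θ α p) x))
    where
    intro : ∀ e → val V p x ≡ true → V at x ⊩ (if e then (B ⇒ var p) else (B ∧' var p))
    intro true  k y x≤y _ = mono V p x y x≤y k
    intro false k         = h , k
    elim : ∀ e → V at x ⊩ (if e then (B ⇒ var p) else (B ∧' var p)) → val V p x ≡ true
    elim true  k = k x (≤-refl x) h
    elim false k = proj₂ k

  θ-update : ∀ α V x → ¬ (V at x ⊩ B) → Update V (θ α ⋆ V) x α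
  θ-update α V x ¬B = (λ y _ → θ-agree α V y) , λ p →
    mk⇔ (elim p (α p) ∘ from (⊩⇔evV V (θ α p) x)) (to (⊩⇔evV V (θ α p) x) ∘ intro p (α p))
    where
    elim : ∀ p e → V at x ⊩ (if e then (B ⇒ var p) else (B ∧' var p)) →
      e ≡ true × (∀ y → x ≤C5 y ≡ true → V at y ⊩ B → val V p y ≡ true)
    elim p true  k = refl , k
    elim p false k = ⊥-elim (¬B (proj₁ k))
    intro : ∀ p e → e ≡ true × (∀ y → x ≤C5 y ≡ true → V at y ⊩ B → val V p y ≡ true) →
      V at x ⊩ (if e then (B ⇒ var p) else (B ∧' var p))
    intro p .true (refl , k) = k

  θ-preserves : ∀ α V x → V at x ⊩ B → (θ α ⋆ V) at x ⊩ B
  θ-preserves α V x h = ⊩-local B x (λ y x≤y → θ-agree α V y (⊩-mono V B x≤y h)) h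

  run : List Assignment → Valuation → Valuation
  run []       V = V
  run (α ∷ βs) V = run βs (θ α ⋆ V)

  -- Substitutions act contravariantly on valuations: `θ α` is the last one substituted, and the
  -- first one to act in `run`.
  Θ : List Assignment → Subst
  Θ []       = var
  Θ (α ∷ βs) = θ α ∘ˢ Θ βs

  run-⊩ : ∀ βs V A x → run βs V at x ⊩ A ⇔ V at x ⊩ (A [ Θ βs ])
  run-⊩ [] V A x = mk⇔ (subst (V at x ⊩_) (sym ([]-var A))) (subst (V at x ⊩_) ([]-var A))
  run-⊩ (α ∷ βs) V A x = mk⇔
    (λ h → subst (V at x ⊩_) (sym ([]-∘ (θ α) (Θ βs) A))
      (to (⋆-⊩ (θ α) V (A [ Θ βs ]) x) (to (run-⊩ βs (θ α ⋆ V) A x) h)))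
    (λ h → from (run-⊩ βs (θ α ⋆ V) A x) (from (⋆-⊩ (θ α) V (A [ Θ βs ]) x)
      (subst (V at x ⊩_) ([]-∘ (θ α) (Θ βs) A) h)))

  run-agree : ∀ βs V x → V at x ⊩ B → AgreeAt V (run βs V) x
  run-agree []       V x h p = refl
  run-agree (α ∷ βs) V x h p =
    trans (θ-agree α V x h p) (run-agree βs (θ α ⋆ V) x (θ-preserves α V x h) p)

  run-preserves : ∀ βs V x → V at x ⊩ B → run βs V at x ⊩ B
  run-preserves []       V x h = h
  run-preserves (α ∷ βs) V x h = run-preserves βs (θ α ⋆ V) x (θ-preserves α V x h)

  -- An unsuccessful attempt `α` changes values at `x` only, and these are overwritten by the next
  -- update because `B` still fails at `x`.
  repairs-θ : ∀ α V x → HoldsAbove V x → ¬ ((θ α ⋆ V) at x ⊩ B) →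
    ∀ {β} → Repairs V x β → Repairs (θ α ⋆ V) x β
  repairs-θ α V x above ¬B' {β} rep V' (agree , upd) = rep V' (agree' , upd')
    where
    V₁ = θ α ⋆ V
    agree' : ∀ y → x ≤C5 y ≡ true → V at y ⊩ B → AgreeAt V V' y
    agree' y x≤y h p = trans (θ-agree α V y h p) (agree y x≤y (θ-preserves α V y h) p)
    back : ∀ y → x ≤C5 y ≡ true → V₁ at y ⊩ B → V at y ⊩ B
    back y x≤y h with above y x≤y
    ... | inj₁ refl = ⊥-elim (¬B' h)
    ... | inj₂ k    = k
    upd' : ∀ p → val V' p x ≡ true ⇔
      (β p ≡ true × (∀ y → x ≤C5 y ≡ true → V at y ⊩ B → val V p y ≡ true))
    upd' p = mk⇔
      (λ e → let βp , k = to (upd p) e in βp , λ y x≤y h →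
        trans (θ-agree α V y h p) (k y x≤y (θ-preserves α V y h)))
      (λ (βp , k) → from (upd p) (βp , λ y x≤y h →
        trans (sym (θ-agree α V y (back y x≤y h) p)) (k y x≤y (back y x≤y h))))

  holdsAbove-θ : ∀ α V x → HoldsAbove V x → HoldsAbove (θ α ⋆ V) x
  holdsAbove-θ α V x above y x≤y with above y x≤y
  ... | inj₁ e = inj₁ e
  ... | inj₂ h = inj₂ (θ-preserves α V y h)

  run-repairs : ∀ βs V x → HoldsAbove V x → Any (Repairs V x) βs → run βs V at x ⊩ B
  run-repairs (α ∷ βs) V x above rep with V at x ⊩? B
  ... | yes h = run-preserves (α ∷ βs) V x h
  run-repairs (α ∷ βs) V x above (here rep) | no ¬B =
    run-preserves βs (θ α ⋆ V) x (rep (θ α ⋆ V) (θ-update α V x ¬B))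
  run-repairs (α ∷ βs) V x above (there rep) | no ¬B with (θ α ⋆ V) at x ⊩? B
  ... | yes h  = run-preserves βs (θ α ⋆ V) x h
  ... | no ¬B' = run-repairs βs (θ α ⋆ V) x (holdsAbove-θ α V x above)
    (Any.map (repairs-θ α V x above ¬B') rep)

  run-++ : ∀ βs γs V → run (βs ++ γs) V ≡ run γs (run βs V)
  run-++ []       γs V = refl
  run-++ (β ∷ βs) γs V = run-++ βs γs (θ β ⋆ V)

  module _ (ext : Extendable) where

    round : ∀ V x → HoldsAbove V x → run αs V at x ⊩ B
    round V x above with V at x ⊩? B
    ... | yes h = run-preserves αs V x h
    ... | no ¬B = run-repairs αs V x above (ext V x ¬B above)

    round-max : ∀ V {x} → Maximal x → run αs V at x ⊩ B
    round-max V {x} m = round V x (maximal-elim m (λ y → y ≡ x ⊎ V at y ⊩ B) (inj₁ refl))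

    unifier : Subst
    unifier = Θ (αs ++ (αs ++ αs))

    unifier-valid : InL (B [ unifier ])
    unifier-valid V x = to (run-⊩ (αs ++ (αs ++ αs)) V B x)
      (subst (_at x ⊩ B) (sym (trans (run-++ αs (αs ++ αs) V) (run-++ αs αs V₁))) (V₃-forces x))
      where
      V₁ V₂ V₃ : Valuation
      V₁ = run αs V
      V₂ = run αs V₁
      V₃ = run αs V₂
      V₂-max : ∀ {x} → Maximal x → V₂ at x ⊩ B
      V₂-max m = run-preserves αs V₁ _ (round-max V m)
      V₂-a : V₂ at a ⊩ B
      V₂-a = round V₁ a (≥a-elim (λ y → y ≡ a ⊎ V₁ at y ⊩ B)
        (inj₁ refl) (inj₂ (round-max V c-max)) (inj₂ (round-max V t-max)))
      V₂-b : V₂ at b ⊩ B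
      V₂-b = round V₁ b (≥b-elim (λ y → y ≡ b ⊎ V₁ at y ⊩ B)
        (inj₁ refl) (inj₂ (round-max V t-max)) (inj₂ (round-max V d-max)))
      V₃-forces : ∀ x → V₃ at x ⊩ B
      V₃-forces a = run-preserves αs V₂ a V₂-a
      V₃-forces b = run-preserves αs V₂ b V₂-b
      V₃-forces c = run-preserves αs V₂ c (V₂-max c-max)
      V₃-forces t = run-preserves αs V₂ t (V₂-max t-max)
      V₃-forces d = run-preserves αs V₂ d (V₂-max d-max)
      V₃-forces r = round V₂ r λ
        { r _ → inj₁ refl
        ; a _ → inj₂ V₂-a
        ; b _ → inj₂ V₂-b
        ; c _ → inj₂ (V₂-max c-max)
        ; t _ → inj₂ (V₂-max t-max)
        ; d _ → inj₂ (V₂-max d-max)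
        }

    -- No `θ` changes anything where `B` holds. Hence any substitution that makes `B` valid absorbs
    -- `unifier`.
    unifier-projective : ∀ V x p → V at x ⊩ B → V at x ⊩ unifier p ⇔ val V p x ≡ true
    unifier-projective V x p h = mk⇔
      (λ k → trans (run-agree βs V x h p) (from (run-⊩ βs V (var p) x) k))
      (λ k → to (run-⊩ βs V (var p) x) (trans (sym (run-agree βs V x h p)) k))
      where βs = αs ++ (αs ++ αs)

-- Assignments to finitely many variables as bit vectors.

Bits : ℕ → Set
Bits = Vec Bool

⟦_⟧ : ∀ {n} → Bits n → Assignment
⟦ [] ⟧    p       = false
⟦ e ∷ w ⟧ zero    = e
⟦ e ∷ w ⟧ (suc p) = ⟦ w ⟧ p

bitsOf : ∀ n → Assignment → Bits n
bitsOf zero    u = []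
bitsOf (suc n) u = u zero ∷ bitsOf n (u ∘ suc)

bitsOf-⟦⟧ : ∀ {n} (w : Bits n) → bitsOf n ⟦ w ⟧ ≡ w
bitsOf-⟦⟧ []      = refl
bitsOf-⟦⟧ (e ∷ w) = cong (e ∷_) (bitsOf-⟦⟧ w)

⟦bitsOf⟧ : ∀ n u → Agree n ⟦ bitsOf n u ⟧ u
⟦bitsOf⟧ (suc n) u zero    h       = refl
⟦bitsOf⟧ (suc n) u (suc p) (s≤s h) = ⟦bitsOf⟧ n (u ∘ suc) p h

bitsOf-cong : ∀ n {u v} → Agree n u v → bitsOf n u ≡ bitsOf n v
bitsOf-cong zero    e = refl
bitsOf-cong (suc n) e = cong₂ _∷_ (e 0 (s≤s z≤n)) (bitsOf-cong n (λ p h → e (suc p) (s≤s h)))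

Agree-sym : ∀ {n u v} → Agree n u v → Agree n v u
Agree-sym e p h = sym (e p h)

Agree-trans : ∀ {n u v w} → Agree n u v → Agree n v w → Agree n u w
Agree-trans e f p h = trans (e p h) (f p h)

bitsOf-≡⇒Agree : ∀ n {u v} → bitsOf n u ≡ bitsOf n v → Agree n u v
bitsOf-≡⇒Agree n {u} {v} e = Agree-trans (Agree-sym (⟦bitsOf⟧ n u))
  (subst (λ w → Agree n ⟦ w ⟧ v) (sym e) (⟦bitsOf⟧ n v))

allBits : ∀ n → List (Bits n)
allBits zero    = [] ∷ []
allBits (suc n) = map (true ∷_) (allBits n) ++ map (false ∷_) (allBits n)

∈-allBits : ∀ {n} (w : Bits n) → w ∈ allBits n
∈-allBits []          = here refl
∈-allBits (true ∷ w)  = ∈-++⁺ˡ (∈-map⁺ (true ∷_) (∈-allBits w))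
∈-allBits (false ∷ w) = ∈-++⁺ʳ (map (true ∷_) (allBits _)) (∈-map⁺ (false ∷_) (∈-allBits w))

-- Finite conjunctions and disjunctions, and formulas describing a value.

⊤' : Fm
⊤' = ⊥' ⇒ ⊥'

¬'_ : Fm → Fm
¬' A = A ⇒ ⊥'

⋀ᶠ ⋁ᶠ : ∀ N → (Fin N → Fm) → Fm
⋀ᶠ zero    f = ⊤'
⋀ᶠ (suc N) f = f zero ∧' ⋀ᶠ N (f ∘ suc)
⋁ᶠ zero    f = ⊥'
⋁ᶠ (suc N) f = f zero ∨' ⋁ᶠ N (f ∘ suc)

⋀ᵇ : ∀ n → (Bits n → Fm) → Fm
⋀ᵇ zero    f = f []
⋀ᵇ (suc n) f = ⋀ᵇ n (f ∘ (true ∷_)) ∧' ⋀ᵇ n (f ∘ (false ∷_))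

⋀ᶠ-⊩ : ∀ {V x} N f → V at x ⊩ ⋀ᶠ N f ⇔ (∀ i → V at x ⊩ f i)
⋀ᶠ-⊩ {V} {x} N f = mk⇔ (elim N f) (intro N f)
  where
  elim : ∀ N f → V at x ⊩ ⋀ᶠ N f → ∀ i → V at x ⊩ f i
  elim (suc N) f (h , k) zero    = h
  elim (suc N) f (h , k) (suc i) = elim N (f ∘ suc) k i
  intro : ∀ N f → (∀ i → V at x ⊩ f i) → V at x ⊩ ⋀ᶠ N f
  intro zero    f h y _ k = k
  intro (suc N) f h       = h zero , intro N (f ∘ suc) (h ∘ suc)

⋁ᶠ-⊩ : ∀ {V x} N f → V at x ⊩ ⋁ᶠ N f ⇔ (∃ λ i → V at x ⊩ f i)
⋁ᶠ-⊩ {V} {x} N f = mk⇔ (elim N f) (λ (i , h) → intro N f i h)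
  where
  elim : ∀ N f → V at x ⊩ ⋁ᶠ N f → ∃ λ i → V at x ⊩ f i
  elim (suc N) f (inj₁ h) = zero , h
  elim (suc N) f (inj₂ h) = let i , k = elim N (f ∘ suc) h in suc i , k
  intro : ∀ N f i → V at x ⊩ f i → V at x ⊩ ⋁ᶠ N f
  intro (suc N) f zero    h = inj₁ h
  intro (suc N) f (suc i) h = inj₂ (intro N (f ∘ suc) i h)

⋀ᵇ-⊩ : ∀ {V x} n f → V at x ⊩ ⋀ᵇ n f ⇔ (∀ w → V at x ⊩ f w)
⋀ᵇ-⊩ {V} {x} n f = mk⇔ (elim n f) (intro n f)
  where
  elim : ∀ n f → V at x ⊩ ⋀ᵇ n f → ∀ w → V at x ⊩ f w
  elim zero    f h       []          = h
  elim (suc n) f (h , k) (true ∷ w)  = elim n _ h w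
  elim (suc n) f (h , k) (false ∷ w) = elim n _ k w
  intro : ∀ n f → (∀ w → V at x ⊩ f w) → V at x ⊩ ⋀ᵇ n f
  intro zero    f h = h []
  intro (suc n) f h = intro n _ (h ∘ (true ∷_)) , intro n _ (h ∘ (false ∷_))

unless : ∀ {P : Set} → Dec P → Fm → Fm
unless (yes _) A = ⊤'
unless (no _)  A = A

unless-⊩ : ∀ {V x} {P : Set} (P? : Dec P) A → V at x ⊩ unless P? A ⇔ (¬ P → V at x ⊩ A)
unless-⊩ (yes p) A = mk⇔ (λ _ ¬p → ⊥-elim (¬p p)) (λ _ _ _ k → k)
unless-⊩ (no ¬p) A = mk⇔ (λ h _ → h) (λ h → h ¬p)

¬-⊩-maximal : ∀ {V x} → Maximal x → ∀ A → ¬ (V at x ⊩ A) → V at x ⊩ (¬' A)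
¬-⊩-maximal {V} m A = maximal-elim m (λ y → ¬ (V at y ⊩ A))

-- Having value exactly `w` means forcing `posᵇ f w` and not forcing `negᵇ f w`. No formula
-- expresses that another one is not forced, so the two halves are kept apart.
posᵇ negᵇ : ∀ {n} → (ℕ → Fm) → Bits n → Fm
posᵇ f []          = ⊤'
posᵇ f (true ∷ w)  = f zero ∧' posᵇ (f ∘ suc) w
posᵇ f (false ∷ w) = posᵇ (f ∘ suc) w
negᵇ f []          = ⊥'
negᵇ f (true ∷ w)  = negᵇ (f ∘ suc) w
negᵇ f (false ∷ w) = f zero ∨' negᵇ (f ∘ suc) w

posᵇ-intro : ∀ {V x n} f (w : Bits n) →
  (∀ p → p < n → ⟦ w ⟧ p ≡ true → V at x ⊩ f p) → V at x ⊩ posᵇ f w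
posᵇ-intro f []          h = λ _ _ k → k
posᵇ-intro f (true ∷ w)  h = h 0 (s≤s z≤n) refl , posᵇ-intro (f ∘ suc) w (λ p l → h (suc p) (s≤s l))
posᵇ-intro f (false ∷ w) h = posᵇ-intro (f ∘ suc) w (λ p l → h (suc p) (s≤s l))

posᵇ-elim : ∀ {V x n} f (w : Bits n) → V at x ⊩ posᵇ f w → ∀ p → ⟦ w ⟧ p ≡ true → V at x ⊩ f p
posᵇ-elim f (true ∷ w)  (h , k) zero    e = h
posᵇ-elim f (true ∷ w)  (h , k) (suc p) e = posᵇ-elim (f ∘ suc) w k p e
posᵇ-elim f (false ∷ w) h       (suc p) e = posᵇ-elim (f ∘ suc) w h p e

negᵇ-intro : ∀ {V x n} f (w : Bits n) p → p < n → ⟦ w ⟧ p ≡ false → V at x ⊩ f p → V at x ⊩ negᵇ f w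
negᵇ-intro f (true ∷ w)  (suc p) (s≤s l) e h = negᵇ-intro (f ∘ suc) w p l e h
negᵇ-intro f (false ∷ w) zero    l       e h = inj₁ h
negᵇ-intro f (false ∷ w) (suc p) (s≤s l) e h = inj₂ (negᵇ-intro (f ∘ suc) w p l e h)

negᵇ-elim : ∀ {V x n} f (w : Bits n) → V at x ⊩ negᵇ f w →
  ∃ λ p → p < n × ⟦ w ⟧ p ≡ false × V at x ⊩ f p
negᵇ-elim f (true ∷ w) h =
  let p , l , e , k = negᵇ-elim (f ∘ suc) w h in suc p , s≤s l , e , k
negᵇ-elim f (false ∷ w) (inj₁ h) = zero , s≤s z≤n , refl , h
negᵇ-elim f (false ∷ w) (inj₂ h) =
  let p , l , e , k = negᵇ-elim (f ∘ suc) w h in suc p , s≤s l , e , k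

posᵇ-negᵇ⇒Agree : ∀ {n} V x f (w : Bits n) →
  V at x ⊩ posᵇ (var ∘ f) w → ¬ (V at x ⊩ negᵇ (var ∘ f) w) → Agree n (λ p → val V (f p) x) ⟦ w ⟧
posᵇ-negᵇ⇒Agree V x f w pos ¬neg p l =
  ⇔→≡ (λ e → ¬false (⟦ w ⟧ p) refl e) (posᵇ-elim (var ∘ f) w pos p)
  where
  ¬false : ∀ e → ⟦ w ⟧ p ≡ e → val V (f p) x ≡ true → ⟦ w ⟧ p ≡ true
  ¬false true  eq _ = eq
  ¬false false eq h = ⊥-elim (¬neg (negᵇ-intro (var ∘ f) w p l eq h))

Agree⇒posᵇ : ∀ {n} V x f (w : Bits n) →
  Agree n (λ p → val V (f p) x) ⟦ w ⟧ → V at x ⊩ posᵇ (var ∘ f) w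
Agree⇒posᵇ V x f w e = posᵇ-intro (var ∘ f) w (λ p l k → trans (e p l) k)

Agree⇒¬negᵇ : ∀ {n} V x f (w : Bits n) →
  Agree n (λ p → val V (f p) x) ⟦ w ⟧ → ¬ (V at x ⊩ negᵇ (var ∘ f) w)
Agree⇒¬negᵇ V x f w e h with negᵇ-elim (var ∘ f) w h
... | p , l , k , v with trans (sym v) (trans (e p l) k)
... | ()

glue : ∀ {X : Set} N → (Fin N → X) → (ℕ → X) → ℕ → X
glue zero    f g m       = g m
glue (suc N) f g zero    = f zero
glue (suc N) f g (suc m) = glue N (f ∘ suc) g m

glue-toℕ : ∀ {X : Set} N (f : Fin N → X) g i → glue N f g (toℕ i) ≡ f i
glue-toℕ (suc N) f g zero    = refl
glue-toℕ (suc N) f g (suc i) = glue-toℕ N (f ∘ suc) g i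

glue-+ : ∀ {X : Set} N (f : Fin N → X) g p → glue N f g (N + p) ≡ g p
glue-+ zero    f g p = refl
glue-+ (suc N) f g p = glue-+ N (f ∘ suc) g p

-- The forks of C5 and the axiomatisation of a family.

data Fork : C5W → C5W → C5W → Set where
  fork-a : Fork a c t
  fork-b : Fork b t d

fork-elim : ∀ {x y z} → Fork x y z → (P : C5W → Set) → P x → P y → P z →
  ∀ y' → x ≤C5 y' ≡ true → P y'
fork-elim fork-a = ≥a-elim
fork-elim fork-b = ≥b-elim

fork-maxˡ : ∀ {x y z} → Fork x y z → Maximal y
fork-maxˡ fork-a = c-max
fork-maxˡ fork-b = t-max

fork-maxʳ : ∀ {x y z} → Fork x y z → Maximal z
fork-maxʳ fork-a = t-max
fork-maxʳ fork-b = d-max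

fork-≤ˡ : ∀ {x y z} → Fork x y z → x ≤C5 y ≡ true
fork-≤ˡ fork-a = refl
fork-≤ˡ fork-b = refl

fork-≤ʳ : ∀ {x y z} → Fork x y z → x ≤C5 z ≡ true
fork-≤ʳ fork-a = refl
fork-≤ʳ fork-b = refl

ev-fork : ∀ {x y z} → Fork x y z → ∀ M A → ev M x A ≡ fork (M y) (M z) (M x) A
ev-fork fork-a M A = refl
ev-fork fork-b M A = refl

ev-maximal : ∀ {x} → Maximal x → ∀ M A → ev M x A ≡ top (M x) A
ev-maximal c-max M A = refl
ev-maximal t-max M A = refl
ev-maximal d-max M A = refl

_⊑_ : Assignment → Assignment → Set
u ⊑ v = ∀ p → u p ≡ true → v p ≡ true

-- A finite family of values at the maximal points, E i j w saying that w is admissible at the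
-- bottom of a fork with upper ends i and j, such that every C5-shaped configuration of admissible
-- forks can be completed at the root to a model of A. E-loop is there because a fork all of whose
-- points have type i is bisimilar to a maximal point of type i.

record Amalgam (n : ℕ) (A : Fm) : Set₁ where
  field
    N        : ℕ
    u        : Fin N → Bits n
    E        : Fin N → Fin N → Bits n → Set
    E?       : ∀ i j w → Dec (E i j w)
    E-sym    : ∀ {i j w} → E i j w → E j i w
    E-loop   : ∀ i → E i i (u i)
    i₀       : Fin N
    -- With `i = j` this also gives, by persistence, the truth of `A` at a maximal point of type
    -- `i`.
    fork-ext : ∀ i j → ∃ λ w → E i j w × ⟦ w ⟧ ⊑ ⟦ u i ⟧ × ⟦ w ⟧ ⊑ ⟦ u j ⟧ ×
                 fork ⟦ u i ⟧ ⟦ u j ⟧ ⟦ w ⟧ A ≡ true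
    -- The shared type `i` is that of `t`; `j` and `k` are the types of `c` and `d`.
    root-ext : ∀ i j k w w' → E i j w → E i k w' → ∃ λ (z : Bits n) →
                 ⟦ z ⟧ ⊑ ⟦ w ⟧ × ⟦ z ⟧ ⊑ ⟦ w' ⟧ ×
                 root (model ⟦ u j ⟧ ⟦ u i ⟧ ⟦ u k ⟧ ⟦ w ⟧ ⟦ w' ⟧ ⟦ z ⟧) A ≡ true

-- The variable q i marks the points all of whose successors have type i; the variables of A are
-- shifted by N. Besides A, the formula B says that every maximal point has exactly one type and
-- that no fork has an inadmissible bottom: in prem i j w, the implication singles out the points
-- with bottom value exactly w that see both i and j, in the manner of Jankov's formulas.

module Describe {n A} (S : Amalgam n A) where
  open Amalgam S

  q : Fin N → Fm
  q i = var (toℕ i)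

  ρ : Subst
  ρ p = var (N + p)

  ends : Fin N → Fin N → Fm
  ends i j = q i ∨' q j

  prem : Fin N → Fin N → Bits n → Fm
  prem i j w = posᵇ ρ w ∧' ((negᵇ ρ w ∨' ((¬' q i) ∨' (¬' q j))) ⇒ ends i j)

  typed disjoint values admissible B : Fm
  -- A point below maximal points of different types carries no mark, hence the double negation.
  typed      = ¬' ¬' ⋁ᶠ N q
  disjoint   = ⋀ᶠ N λ i → ⋀ᶠ N λ j → unless (i Fin.≟ j) (¬' (q i ∧' q j))
  values     = ⋀ᶠ N λ i → (q i ⇒ posᵇ ρ (u i)) ∧' (¬' (q i ∧' negᵇ ρ (u i)))
  admissible = ⋀ᶠ N λ i → ⋀ᶠ N λ j → ⋀ᵇ n λ w → unless (E? i j w) (prem i j w ⇒ ends i j)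
  B = typed ∧' disjoint ∧' values ∧' admissible ∧' (A [ ρ ])

  shift : Valuation → Model
  shift V x p = val V (N + p) x

  bits : Valuation → C5W → Bits n
  bits V x = bitsOf n (shift V x)

  -- The share of `B` that concerns `x` itself, with every implication read at `x` only. When a
  -- model is extended downwards, just the new point has to be checked.
  record Local (V : Valuation) (x : C5W) : Set where
    field
      some-q  : ¬ (V at x ⊩ (¬' ⋁ᶠ N q))
      q-uniq  : ∀ i j → V at x ⊩ q i → V at x ⊩ q j → i ≡ j
      q-value : ∀ i → V at x ⊩ q i → Agree n (shift V x) ⟦ u i ⟧
      q-adm   : ∀ i j w → V at x ⊩ prem i j w → E i j w ⊎ V at x ⊩ ends i j
      A-holds : V at x ⊩ (A [ ρ ])
  open Local

  bits-≡ : ∀ V x w → Agree n (shift V x) ⟦ w ⟧ → bits V x ≡ w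
  bits-≡ V x w e = trans (bitsOf-cong n e) (bitsOf-⟦⟧ w)

  ⊩B⇒Local : ∀ V x → V at x ⊩ B → Local V x
  ⊩B⇒Local V x (hT , hD , hV , hE , hA) = record
    { some-q  = hT x (≤-refl x)
    ; q-uniq  = uniq
    ; q-value = λ i h → let pos , ¬neg = to (⋀ᶠ-⊩ N _) hV i in
        posᵇ-negᵇ⇒Agree V x (N +_) (u i) (pos x (≤-refl x) h) (λ k → ¬neg x (≤-refl x) (h , k))
    ; q-adm   = adm
    ; A-holds = hA }
    where
    uniq : ∀ i j → V at x ⊩ q i → V at x ⊩ q j → i ≡ j
    uniq i j h k with i Fin.≟ j | to (⋀ᶠ-⊩ N _) (to (⋀ᶠ-⊩ N _) hD i) j
    ... | yes e | _ = e
    ... | no _  | f = ⊥-elim (f x (≤-refl x) (h , k))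
    adm : ∀ i j w → V at x ⊩ prem i j w → E i j w ⊎ V at x ⊩ ends i j
    adm i j w h with E? i j w | to (⋀ᵇ-⊩ n _) (to (⋀ᶠ-⊩ N _) (to (⋀ᶠ-⊩ N _) hE i) j) w
    ... | yes e | _ = inj₁ e
    ... | no _  | f = inj₂ (f x (≤-refl x) h)

  Local⇒⊩B : ∀ V x → (∀ y → x ≤C5 y ≡ true → Local V y) → V at x ⊩ B
  Local⇒⊩B V x loc =
      (λ y x≤y → some-q (loc y x≤y))
    , from (⋀ᶠ-⊩ N _) (λ i → from (⋀ᶠ-⊩ N _) (λ j → from (unless-⊩ (i Fin.≟ j) _)
        (λ i≢j y x≤y (h , k) → i≢j (q-uniq (loc y x≤y) i j h k))))
    , from (⋀ᶠ-⊩ N _) (λ i →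
        (λ y x≤y h → Agree⇒posᵇ V y (N +_) (u i) (q-value (loc y x≤y) i h)) ,
        (λ y x≤y (h , k) → Agree⇒¬negᵇ V y (N +_) (u i) (q-value (loc y x≤y) i h) k))
    , from (⋀ᶠ-⊩ N _) (λ i → from (⋀ᶠ-⊩ N _) (λ j → from (⋀ᵇ-⊩ n _) (λ w →
        from (unless-⊩ (E? i j w) _) (λ ¬E y x≤y h →
          [ (λ e → ⊥-elim (¬E e)) , id ]′ (q-adm (loc y x≤y) i j w h)))))
    , A-holds (loc x (≤-refl x))

  ⊩A[ρ]⇔ : ∀ V x → V at x ⊩ (A [ ρ ]) ⇔ ev (shift V) x A ≡ true
  ⊩A[ρ]⇔ V x = mk⇔
    (λ h → to (⊩⇔ev rep A x) (from (⋆-⊩ ρ V A x) h))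
    (λ e → to (⋆-⊩ ρ V A x) (from (⊩⇔ev rep A x) e))
    where
    rep : Represents (shift V) (ρ ⋆ V)
    rep p r = refl
    rep p a = refl
    rep p b = refl
    rep p c = refl
    rep p t = refl
    rep p d = refl

  maximal-q : ∀ {V x} → Maximal x → ¬ (V at x ⊩ (¬' ⋁ᶠ N q)) → ∃ λ i → V at x ⊩ q i
  maximal-q {V} {x} m h with V at x ⊩? ⋁ᶠ N q
  ... | yes k = to (⋁ᶠ-⊩ N q) k
  ... | no ¬k = ⊥-elim (h (¬-⊩-maximal m (⋁ᶠ N q) ¬k))

  maximal-prem : ∀ {V x} → Maximal x → ∀ i j w → V at x ⊩ prem i j w → V at x ⊩ ends i j
  maximal-prem {V} {x} m i j w (_ , h) with V at x ⊩? q i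
  ... | yes k = inj₁ k
  ... | no ¬k = h x (≤-refl x) (inj₂ (inj₁ (¬-⊩-maximal {V} m (q i) ¬k)))

  prem-value : ∀ {V x} i j w → V at x ⊩ prem i j w → ¬ (V at x ⊩ ends i j) → bits V x ≡ w
  prem-value {V} {x} i j w (pos , h) ¬ends =
    bits-≡ V x w (posᵇ-negᵇ⇒Agree V x (N +_) w pos (λ k → ¬ends (h x (≤-refl x) (inj₁ k))))

  -- If `x` satisfies `prem i j w` and neither end, then it has value `w` and sees `i` and `j`; each
  -- maximal point above it is of type `i` or `j`. So `i` and `j` are `i₁` and `i₂` in some order,
  -- and the assumed admissibility applies.
  fork-adm : ∀ {V x y z} → Fork x y z → Local V y → Local V z →
    ∀ {i₁ i₂} → V at y ⊩ q i₁ → V at z ⊩ q i₂ → E i₁ i₂ (bits V x) →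
    ∀ i j w → V at x ⊩ prem i j w → E i j w ⊎ V at x ⊩ ends i j
  fork-adm {V} {x} {y} {z} f locy locz {i₁} {i₂} hy hz e i j w h with V at x ⊩? ends i j
  ... | yes k = inj₂ k
  ... | no ¬k = inj₁ (match (end locy hy (maximal-prem (fork-maxˡ f) i j w
                                            (⊩-mono V (prem i j w) (fork-≤ˡ f) h)))
                            (end locz hz (maximal-prem (fork-maxʳ f) i j w
                                            (⊩-mono V (prem i j w) (fork-≤ʳ f) h))))
    where
    end : ∀ {y k} → Local V y → V at y ⊩ q k → V at y ⊩ ends i j → i ≡ k ⊎ j ≡ k
    end loc hk (inj₁ hi) = inj₁ (q-uniq loc i _ hi hk)
    end loc hk (inj₂ hj) = inj₂ (q-uniq loc j _ hj hk)
    seen : ∀ k → (V at x ⊩ (¬' q k) → V at x ⊩ ends i j) →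
      (V at x ⊩ q k → V at x ⊩ ends i j) → k ≡ i₁ ⊎ k ≡ i₂
    seen k n₁ n₂ with k Fin.≟ i₁ | k Fin.≟ i₂
    ... | yes p | _     = inj₁ p
    ... | no _  | yes p = inj₂ p
    ... | no p₁ | no p₂ = ⊥-elim (¬k (n₁ (fork-elim f (λ y → ¬ (V at y ⊩ q k))
      (λ l → ¬k (n₂ l)) (λ l → p₁ (q-uniq locy k i₁ l hy)) (λ l → p₂ (q-uniq locz k i₂ l hz)))))
    seen-i : i ≡ i₁ ⊎ i ≡ i₂
    seen-i = seen i (λ l → proj₂ h x (≤-refl x) (inj₂ (inj₁ l))) inj₁
    seen-j : j ≡ i₁ ⊎ j ≡ i₂
    seen-j = seen j (λ l → proj₂ h x (≤-refl x) (inj₂ (inj₂ l))) inj₂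
    e' : E i₁ i₂ w
    e' = subst (E i₁ i₂) (prem-value i j w h ¬k) e
    match : i ≡ i₁ ⊎ j ≡ i₁ → i ≡ i₂ ⊎ j ≡ i₂ → E i j w
    match (inj₁ refl) (inj₂ refl) = e'
    match (inj₂ refl) (inj₁ refl) = E-sym e'
    -- Here `i` is the type of both ends; as `j` is seen too, it is the same type.
    match (inj₁ refl) (inj₁ refl) with seen-j
    ... | inj₁ refl = e'
    ... | inj₂ refl = e'
    match (inj₂ refl) (inj₂ refl) with seen-i
    ... | inj₁ refl = e'
    ... | inj₂ refl = e'

  -- If `x` is marked by an end, persistence gives both ends that type and `x` its value, so
  -- `E-loop` applies. Otherwise `x` satisfies `prem` for its own value and `q-adm` gives the claim.
  fork-E : ∀ {V x y z} → Fork x y z → Local V x → Local V y → Local V z →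
    ∀ {i₁ i₂} → V at y ⊩ q i₁ → V at z ⊩ q i₂ → E i₁ i₂ (bits V x)
  fork-E {V} {x} {y} {z} f locx locy locz {i₁} {i₂} hy hz with V at x ⊩? ends i₁ i₂
  ... | yes (inj₁ h) with q-uniq locz i₁ i₂ (⊩-mono V (q i₁) (fork-≤ʳ f) h) hz
  ... | refl = subst (E i₁ i₁) (sym (bits-≡ V x (u i₁) (q-value locx i₁ h))) (E-loop i₁)
  fork-E {V} {x} {y} {z} f locx locy locz {i₁} {i₂} hy hz | yes (inj₂ h)
    with q-uniq locy i₂ i₁ (⊩-mono V (q i₂) (fork-≤ˡ f) h) hy
  ... | refl = subst (E i₁ i₁) (sym (bits-≡ V x (u i₁) (q-value locx i₁ h))) (E-loop i₁)
  fork-E {V} {x} {y} {z} f locx locy locz {i₁} {i₂} hy hz | no ¬h =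
    [ id , (λ h → ⊥-elim (¬h h)) ]′ (q-adm locx i₁ i₂ w₀ (Agree⇒posᵇ V x (N +_) w₀ agree , imp))
    where
    w₀ = bits V x
    agree : Agree n (shift V x) ⟦ w₀ ⟧
    agree = Agree-sym (⟦bitsOf⟧ n (shift V x))
    Imp : C5W → Set
    Imp y = V at y ⊩ (negᵇ ρ w₀ ∨' ((¬' q i₁) ∨' (¬' q i₂))) → V at y ⊩ ends i₁ i₂
    imp-x : Imp x
    imp-x (inj₁ k)        = ⊥-elim (Agree⇒¬negᵇ V x (N +_) w₀ agree k)
    imp-x (inj₂ (inj₁ k)) = ⊥-elim (k y (fork-≤ˡ f) hy)
    imp-x (inj₂ (inj₂ k)) = ⊥-elim (k z (fork-≤ʳ f) hz)
    imp : ∀ y' → x ≤C5 y' ≡ true → Imp y'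
    imp = fork-elim f Imp imp-x (λ _ → inj₁ hy) (λ _ → inj₂ hz)

  -- A root satisfying prem i j w but neither end passes prem i j w on to a and b, where it is
  -- settled unless both are marked by the same q k.

  root-adm : ∀ {V} → (∀ y → y ≢ r → Local V y) →
    (∀ k → V at a ⊩ q k → V at b ⊩ q k → E k k (bits V r) ⊎ V at r ⊩ q k) →
    ∀ i j w → V at r ⊩ prem i j w → E i j w ⊎ V at r ⊩ ends i j
  root-adm {V} loc collapse i j w h with V at r ⊩? ends i j
  ... | yes k = inj₂ k
  ... | no ¬k with q-adm (loc a λ ()) i j w (⊩-mono V (prem i j w) {r} {a} refl h)
                 | q-adm (loc b λ ()) i j w (⊩-mono V (prem i j w) {r} {b} refl h)
  ... | inj₁ e  | _       = inj₁ e
  ... | inj₂ _  | inj₁ e  = inj₁ e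
  ... | inj₂ ha | inj₂ hb = inj₁ (both (endOf ha) (endOf hb))
    where
    endOf : ∀ {x} → V at x ⊩ ends i j → ∃ λ k → (k ≡ i ⊎ k ≡ j) × V at x ⊩ q k
    endOf (inj₁ l) = i , inj₁ refl , l
    endOf (inj₂ l) = j , inj₂ refl , l
    only : ∀ {k} → V at a ⊩ q k → V at b ⊩ q k → ∀ l → l ≢ k → V at r ⊩ (¬' q l)
    only {k} ka kb l l≢k y _ m = l≢k (go y m)
      where
      go : ∀ y → V at y ⊩ q l → l ≡ k
      go r m = q-uniq (loc a λ ()) l k (⊩-mono V (q l) {r} {a} refl m) ka
      go a m = q-uniq (loc a λ ()) l k m ka
      go b m = q-uniq (loc b λ ()) l k m kb
      go c m = q-uniq (loc c λ ()) l k m (⊩-mono V (q k) {a} {c} refl ka)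
      go t m = q-uniq (loc t λ ()) l k m (⊩-mono V (q k) {a} {t} refl ka)
      go d m = q-uniq (loc d λ ()) l k m (⊩-mono V (q k) {b} {d} refl kb)
    both : (∃ λ k → (k ≡ i ⊎ k ≡ j) × V at a ⊩ q k) →
      (∃ λ k → (k ≡ i ⊎ k ≡ j) × V at b ⊩ q k) → E i j w
    both (k , k∈ , ka) (k' , _ , kb)
      -- The point `t` lies above both `a` and `b` and carries only one mark.
      with q-uniq (loc t λ ()) k k'
        (⊩-mono V (q k) {a} {t} refl ka) (⊩-mono V (q k') {b} {t} refl kb)
    ... | refl with i Fin.≟ k | j Fin.≟ k
    ... | no i≢ | _ = ⊥-elim (¬k (proj₂ h r refl (inj₂ (inj₁ (only ka kb i i≢)))))
    ... | yes _ | no j≢ = ⊥-elim (¬k (proj₂ h r refl (inj₂ (inj₂ (only ka kb j j≢)))))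
    ... | yes refl | yes refl with collapse k ka kb
    ... | inj₁ e = subst (E i j) (prem-value i j w h ¬k) e
    ... | inj₂ l = ⊥-elim (¬k (inj₁ l))

-- The extension property of `B`.

module Extend {n A} (S : Amalgam n A) (below : VarsBelow n A) where
  open Amalgam S
  open Describe S
  open Local

  -- `mark` repairs maximal points and roots whose two covers share a mark; `plain` repairs all
  -- other points.
  mark : Fin N → Assignment
  mark i = glue N (λ j → does (i Fin.≟ j)) ⟦ u i ⟧

  plain : Bits n → Assignment
  plain w = glue N (λ _ → false) ⟦ w ⟧

  αs : List Assignment
  αs = map mark (allFin N) ++ map plain (allBits n)

  open Projective B αs

  -- `Update` rewritten in terms of the new valuation alone; `update-assigned` obtains it when `B`
  -- fails at `x` and holds strictly above.
  Assigned : Valuation → C5W → Assignment → Set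
  Assigned V x α = ∀ p → val V p x ≡ true ⇔
    (α p ≡ true × (∀ y → x ≤C5 y ≡ true → y ≡ x ⊎ val V p y ≡ true))

  repairs-mark : ∀ {V x} i → Repairs V x (mark i) → Any (Repairs V x) αs
  repairs-mark i rep = lose (∈-++⁺ˡ (∈-map⁺ mark (∈-allFin i))) rep

  repairs-plain : ∀ {V x} w → Repairs V x (plain w) → Any (Repairs V x) αs
  repairs-plain w rep = lose (∈-++⁺ʳ (map mark (allFin N)) (∈-map⁺ plain (∈-allBits w))) rep

  update-agree : ∀ {V V' x α} → Update V V' x α →
    ∀ y → x ≤C5 y ≡ true → V at y ⊩ B → V' at y ⊩ B
  update-agree {V} (agree , _) y x≤y h = ⊩-local B y
    (λ z y≤z → agree z (≤-trans _ y z x≤y y≤z) (⊩-mono V B y≤z h)) h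

  update-assigned : ∀ {V V' x α} → ¬ (V at x ⊩ B) → HoldsAbove V x → Update V V' x α →
    Assigned V' x α
  update-assigned {V} {V'} {x} ¬B above (agree , upd) p = mk⇔
    (λ e → let αp , k = to (upd p) e in αp , λ y x≤y → up y x≤y (k y x≤y) (above y x≤y))
    (λ (αp , k) → from (upd p) (αp , λ y x≤y h → down y x≤y h (k y x≤y)))
    where
    up : ∀ y → x ≤C5 y ≡ true → (V at y ⊩ B → val V p y ≡ true) → y ≡ x ⊎ V at y ⊩ B →
      y ≡ x ⊎ val V' p y ≡ true
    up y x≤y k (inj₁ e) = inj₁ e
    up y x≤y k (inj₂ h) = inj₂ (trans (sym (agree y x≤y h p)) (k h))
    down : ∀ y → x ≤C5 y ≡ true → V at y ⊩ B → y ≡ x ⊎ val V' p y ≡ true → val V p y ≡ true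
    down y x≤y h (inj₁ refl) = ⊥-elim (¬B h)
    down y x≤y h (inj₂ k)    = trans (agree y x≤y h p) k

  repairs-intro : ∀ {V x α} → ¬ (V at x ⊩ B) → HoldsAbove V x →
    (∀ V' → (∀ y → x ≤C5 y ≡ true → V at y ⊩ B → AgreeAt V V' y) → HoldsAbove V' x →
      Assigned V' x α → Local V' x) →
    Repairs V x α
  repairs-intro {V} {x} {α} ¬B above loc V' upd = Local⇒⊩B V' x loc'
    where
    above' : HoldsAbove V' x
    above' y x≤y with above y x≤y
    ... | inj₁ e = inj₁ e
    ... | inj₂ h = inj₂ (update-agree {V} {V'} upd y x≤y h)
    loc' : ∀ y → x ≤C5 y ≡ true → Local V' y
    loc' y x≤y with above' y x≤y
    ... | inj₁ refl = loc V' (proj₁ upd) above' (update-assigned {V} {V'} ¬B above upd)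
    ... | inj₂ h    = ⊩B⇒Local V' y h

  mark-q : ∀ {i} j → mark i (toℕ j) ≡ true → i ≡ j
  mark-q {i} j e with i Fin.≟ j | trans (sym (glue-toℕ N (λ j → does (i Fin.≟ j)) ⟦ u i ⟧ j)) e
  ... | yes p | _ = p
  ... | no _  | ()

  mark-self : ∀ i → mark i (toℕ i) ≡ true
  mark-self i = trans (glue-toℕ N _ _ i) (dec-true (i Fin.≟ i) refl)

  mark-value : ∀ i p → mark i (N + p) ≡ ⟦ u i ⟧ p
  mark-value i = glue-+ N _ _

  plain-value : ∀ w p → plain w (N + p) ≡ ⟦ w ⟧ p
  plain-value w = glue-+ N _ _

  plain-q : ∀ {V x w} → Assigned V x (plain w) → ∀ i → ¬ (V at x ⊩ q i)
  plain-q {V} {x} {w} asg i h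
    with trans (sym (proj₁ (to (asg (toℕ i)) h))) (glue-toℕ N (λ _ → false) ⟦ w ⟧ i)
  ... | ()

  extend-maximal : ∀ {x} → Maximal x → ∀ V → ¬ (V at x ⊩ B) → HoldsAbove V x →
    Any (Repairs V x) αs
  -- Nothing above restricts the choice, so any type of the family will do.
  extend-maximal {x} m V ¬B above = repairs-mark i₀ (repairs-intro ¬B above λ V' _ _ asg →
    let
      here' : ∀ p → mark i₀ p ≡ true → val V' p x ≡ true
      here' p e = from (asg p) (e , maximal-elim m (λ y → y ≡ x ⊎ val V' p y ≡ true) (inj₁ refl))
      q₀ : V' at x ⊩ q i₀
      q₀ = here' (toℕ i₀) (mark-self i₀)
      which : ∀ i → V' at x ⊩ q i → i₀ ≡ i
      which i h = mark-q i (proj₁ (to (asg (toℕ i)) h))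
      value : Agree n (shift V' x) ⟦ u i₀ ⟧
      value p _ = ⇔→≡
        (λ e → trans (sym (mark-value i₀ p)) (proj₁ (to (asg (N + p)) e)))
        (λ e → here' (N + p) (trans (mark-value i₀ p) e))
      _ , _ , _ , _ , A-fork = fork-ext i₀ i₀
    in record
      { some-q  = λ h → h x (≤-refl x) (from (⋁ᶠ-⊩ N q) (i₀ , q₀))
      ; q-uniq  = λ i j h k → trans (sym (which i h)) (which j k)
      ; q-value = λ i h → subst (λ i → Agree n (shift V' x) ⟦ u i ⟧) (which i h) value
      ; q-adm   = λ i j w h → inj₂ (maximal-prem m i j w h)
      ; A-holds = from (⊩A[ρ]⇔ V' x) (trans (ev-maximal m (shift V') A)
          (trans (top-local value A below) (proj₁ (fork-persistent A A-fork))))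
      })

  above-fork : ∀ {V x y z} → Fork x y z → HoldsAbove V x → V at y ⊩ B × V at z ⊩ B
  above-fork fork-a above with above c refl | above t refl
  ... | inj₂ h | inj₂ k = h , k
  above-fork fork-b above with above t refl | above d refl
  ... | inj₂ h | inj₂ k = h , k

  extend-fork : ∀ {x y z} → Fork x y z → ∀ V → ¬ (V at x ⊩ B) → HoldsAbove V x →
    Any (Repairs V x) αs
  extend-fork {x} {y} {z} f V ¬B above
    with above-fork f above
  ... | By , Bz with maximal-q (fork-maxˡ f) (some-q (⊩B⇒Local V y By))
                   | maximal-q (fork-maxʳ f) (some-q (⊩B⇒Local V z Bz))
  ... | i , qi | j , qj with fork-ext i j
  ... | w , e , w⊑i , w⊑j , A-fork =
    repairs-plain w (repairs-intro ¬B above λ V' agree above' asg →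
      let
        By' , Bz' = above-fork f above'
        locy = ⊩B⇒Local V' y By'
        locz = ⊩B⇒Local V' z Bz'
        qi' : V' at y ⊩ q i
        qi' = trans (sym (agree y (fork-≤ˡ f) By (toℕ i))) qi
        qj' : V' at z ⊩ q j
        qj' = trans (sym (agree z (fork-≤ʳ f) Bz (toℕ j))) qj
        value : Agree n (shift V' x) ⟦ w ⟧
        value p l = ⇔→≡
          (λ h → trans (sym (plain-value w p)) (proj₁ (to (asg (N + p)) h)))
          (λ h → from (asg (N + p)) (trans (plain-value w p) h ,
            fork-elim f (λ y → y ≡ x ⊎ val V' (N + p) y ≡ true) (inj₁ refl)
              (inj₂ (trans (q-value locy i qi' p l) (w⊑i p h)))
              (inj₂ (trans (q-value locz j qj' p l) (w⊑j p h)))))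
      in record
        { some-q  = λ h → some-q locy (⊩-mono V' (¬' ⋁ᶠ N q) (fork-≤ˡ f) h)
        ; q-uniq  = λ k _ h → ⊥-elim (plain-q {V'} {w = w} asg k h)
        ; q-value = λ k h → ⊥-elim (plain-q {V'} {w = w} asg k h)
        ; q-adm   = fork-adm f locy locz qi' qj' (subst (E i j) (sym (bits-≡ V' x w value)) e)
        ; A-holds = from (⊩A[ρ]⇔ V' x) (trans (ev-fork f (shift V') A)
            (trans (fork-local (q-value locy i qi') (q-value locz j qj') value A below) A-fork))
        })

  holdsAbove-r : ∀ {V} → HoldsAbove V r → ∀ y → y ≢ r → V at y ⊩ B
  holdsAbove-r above y y≢r with above y refl
  ... | inj₁ e = ⊥-elim (y≢r e)
  ... | inj₂ h = h

  local-above : ∀ {V} → HoldsAbove V r → ∀ y → y ≢ r → Local V y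
  local-above {V} above y y≢r = ⊩B⇒Local V y (holdsAbove-r above y y≢r)

  -- When a and b carry the same mark, the root must be given that mark too: the value offered by
  -- root-ext could make it an inadmissible fork with both ends equal.

  extend-root : ∀ V → ¬ (V at r ⊩ B) → HoldsAbove V r → Any (Repairs V r) αs
  extend-root V ¬B above with Fin.any? (λ l → (V at a ⊩? q l) ×-dec (V at b ⊩? q l))
  ... | yes (l , la , lb) = repairs-mark l (repairs-intro ¬B above λ V' agree above' asg →
    let
      loc = local-above above'
      agree' : ∀ y → y ≢ r → V at y ⊩ q l → V' at y ⊩ q l
      agree' y y≢r h = trans (sym (agree y refl (holdsAbove-r above y y≢r) (toℕ l))) h
      la' : V' at a ⊩ q l
      la' = agree' a (λ ()) la
      lb' : V' at b ⊩ q l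
      lb' = agree' b (λ ()) lb
      marked : ∀ y → y ≢ r → V' at y ⊩ q l
      marked = λ
        { r y≢r → ⊥-elim (y≢r refl)
        ; a _ → la'
        ; b _ → lb'
        ; c _ → ⊩-mono V' (q l) {a} {c} refl la'
        ; t _ → ⊩-mono V' (q l) {a} {t} refl la'
        ; d _ → ⊩-mono V' (q l) {b} {d} refl lb' }
      lift : ∀ {P : C5W → Set} → (∀ y → y ≢ r → P y) → ∀ y → r ≤C5 y ≡ true → y ≡ r ⊎ P y
      lift h = λ
        { r _ → inj₁ refl
        ; a _ → inj₂ (h a (λ ()))
        ; b _ → inj₂ (h b (λ ()))
        ; c _ → inj₂ (h c (λ ()))
        ; t _ → inj₂ (h t (λ ()))
        ; d _ → inj₂ (h d (λ ())) }
      lr : V' at r ⊩ q l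
      lr = from (asg (toℕ l)) (mark-self l , lift marked)
      which : ∀ {i} → V' at a ⊩ q i → l ≡ i
      which h = q-uniq (loc a (λ ())) l _ la' h
      which-r : ∀ i → V' at r ⊩ q i → l ≡ i
      which-r i h = which {i} (⊩-mono V' (q i) {r} {a} refl h)
      value-r : Agree n (shift V' r) ⟦ u l ⟧
      value-r p p<n = ⇔→≡
        (λ e → trans (sym (mark-value l p)) (proj₁ (to (asg (N + p)) e)))
        (λ e → from (asg (N + p)) (trans (mark-value l p) e ,
          lift λ y y≢r → trans (q-value (loc y y≢r) l (marked y y≢r) p p<n) e))
      value : ∀ y → y ≢ r → Agree n (shift V' y) ⟦ u l ⟧
      value y y≢r = q-value (loc y y≢r) l (marked y y≢r)
      ul = ⟦ u l ⟧
      values' : ∀ y → Agree n (shift V' y) (model ul ul ul ul ul ul y)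
      values' = λ
        { r → value-r
        ; a → value a (λ ())
        ; b → value b (λ ())
        ; c → value c (λ ())
        ; t → value t (λ ())
        ; d → value d (λ ()) }
      _ , _ , _ , _ , A-fork = fork-ext l l
    in record
      { some-q  = λ h → h r refl (from (⋁ᶠ-⊩ N q) (l , lr))
      ; q-uniq  = λ i j h k → trans (sym (which-r i h)) (which-r j k)
      ; q-value = λ i h → subst (λ i → Agree n (shift V' r) ⟦ u i ⟧) (which-r i h) value-r
      ; q-adm   = root-adm loc λ k ka _ → inj₂ (subst (λ k → V' at r ⊩ q k) (which {k} ka) lr)
      ; A-holds = from (⊩A[ρ]⇔ V' r) (trans (root-local values' A below)
          (trans (root-const ul ul A) (trans (fork-const ul A) (proj₁ (fork-persistent A A-fork)))))
      })
  ... | no ¬same with local-above {V} above a (λ ()) | local-above {V} above b (λ ())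
    | local-above {V} above c (λ ()) | local-above {V} above t (λ ())
    | local-above {V} above d (λ ())
  ... | loca | locb | locc | loct | locd
    with maximal-q c-max (some-q locc) | maximal-q t-max (some-q loct)
       | maximal-q d-max (some-q locd)
  ... | i , qi | j , qj | k , qk
    -- `root-ext` takes the type of `t` first, whereas `fork-a` lists `c` before `t`; hence `E-sym`.
    with root-ext j i k (bits V a) (bits V b)
           (E-sym (fork-E fork-a loca locc loct qi qj)) (fork-E fork-b locb loct locd qj qk)
  ... | z , z⊑a , z⊑b , A-root = repairs-plain z (repairs-intro ¬B above λ V' agree above' asg →
    let
      loc = local-above above'
      agree' : ∀ y → y ≢ r → AgreeAt V V' y
      agree' y y≢r = agree y refl (holdsAbove-r above y y≢r)
      same : ∀ y → y ≢ r → Agree n (shift V' y) (shift V y)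
      same y y≢r p _ = sym (agree' y y≢r (N + p))
      value-a : Agree n (shift V' a) ⟦ bits V a ⟧
      value-a = Agree-trans (same a (λ ())) (Agree-sym (⟦bitsOf⟧ n (shift V a)))
      value-b : Agree n (shift V' b) ⟦ bits V b ⟧
      value-b = Agree-trans (same b (λ ())) (Agree-sym (⟦bitsOf⟧ n (shift V b)))
      za : ∀ p → p < n → ⟦ z ⟧ p ≡ true → val V' (N + p) a ≡ true
      za p l e = trans (value-a p l) (z⊑a p e)
      zb : ∀ p → p < n → ⟦ z ⟧ p ≡ true → val V' (N + p) b ≡ true
      zb p l e = trans (value-b p l) (z⊑b p e)
      value-r : Agree n (shift V' r) ⟦ z ⟧
      value-r p l = ⇔→≡
        (λ h → trans (sym (plain-value z p)) (proj₁ (to (asg (N + p)) h)))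
        (λ h → from (asg (N + p)) (trans (plain-value z p) h , λ
          { r _ → inj₁ refl
          ; a _ → inj₂ (za p l h)
          ; b _ → inj₂ (zb p l h)
          ; c _ → inj₂ (mono V' (N + p) a c refl (za p l h))
          ; t _ → inj₂ (mono V' (N + p) a t refl (za p l h))
          ; d _ → inj₂ (mono V' (N + p) b d refl (zb p l h)) }))
      values' : ∀ y → Agree n (shift V' y)
        (model ⟦ u i ⟧ ⟦ u j ⟧ ⟦ u k ⟧ ⟦ bits V a ⟧ ⟦ bits V b ⟧ ⟦ z ⟧ y)
      values' = λ
        { r → value-r
        ; a → value-a
        ; b → value-b
        ; c → Agree-trans (same c (λ ())) (q-value locc i qi)
        ; t → Agree-trans (same t (λ ())) (q-value loct j qj)
        ; d → Agree-trans (same d (λ ())) (q-value locd k qk) }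
    in record
      { some-q  = λ h → some-q (loc a (λ ())) (⊩-mono V' (¬' ⋁ᶠ N q) {r} {a} refl h)
      ; q-uniq  = λ i' _ h → ⊥-elim (plain-q {V'} {w = z} asg i' h)
      ; q-value = λ i' h → ⊥-elim (plain-q {V'} {w = z} asg i' h)
      ; q-adm   = root-adm loc λ l la lb → ⊥-elim (¬same
          (l , trans (agree' a (λ ()) (toℕ l)) la , trans (agree' b (λ ()) (toℕ l)) lb))
      ; A-holds = from (⊩A[ρ]⇔ V' r) (trans (root-local values' A below) A-root)
      })

  extendable : Extendable
  extendable V r = extend-root V
  extendable V a = extend-fork fork-a V
  extendable V b = extend-fork fork-b V
  extendable V c = extend-maximal c-max V
  extendable V t = extend-maximal t-max V
  extendable V d = extend-maximal d-max V

-- Extending a unifier of `A` to a unifier of `B`.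

when : ∀ {P : Set} → Dec P → Fm → Fm
when (yes _) A = A
when (no _)  A = ⊥'

when-⊩ : ∀ {V x} {P : Set} (P? : Dec P) A → V at x ⊩ when P? A ⇔ (P × V at x ⊩ A)
when-⊩ (yes p) A = mk⇔ (p ,_) proj₂
when-⊩ (no ¬p) A = mk⇔ (λ ()) (λ (p , _) → ¬p p)

⋁ᵇ : ∀ n → (Bits n → Fm) → Fm
⋁ᵇ zero    f = f []
⋁ᵇ (suc n) f = ⋁ᵇ n (f ∘ (true ∷_)) ∨' ⋁ᵇ n (f ∘ (false ∷_))

⋁ᵇ-⊩ : ∀ {V x} n f → V at x ⊩ ⋁ᵇ n f ⇔ (∃ λ w → V at x ⊩ f w)
⋁ᵇ-⊩ {V} {x} n f = mk⇔ (elim n f) (λ (w , h) → intro n f w h)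
  where
  elim : ∀ n f → V at x ⊩ ⋁ᵇ n f → ∃ λ w → V at x ⊩ f w
  elim zero    f h        = [] , h
  elim (suc n) f (inj₁ h) = let w , k = elim n _ h in true ∷ w , k
  elim (suc n) f (inj₂ h) = let w , k = elim n _ h in false ∷ w , k
  intro : ∀ n f w → V at x ⊩ f w → V at x ⊩ ⋁ᵇ n f
  intro zero    f []          h = h
  intro (suc n) f (true ∷ w)  h = inj₁ (intro n _ w h)
  intro (suc n) f (false ∷ w) h = inj₂ (intro n _ w h)

bitsᵗ : ∀ {k} n → Subst → Bits k → Bits n
bitsᵗ n μ û = bitsOf n (top ⟦ û ⟧ ∘ μ)

bitsᶠ : ∀ {k} n → Subst → Bits k → Bits k → Bits k → Bits n
bitsᶠ n μ û v̂ ŵ = bitsOf n (fork ⟦ û ⟧ ⟦ v̂ ⟧ ⟦ ŵ ⟧ ∘ μ)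

-- The condition under which `μ` factors through the unifier built from `S`: every assignment to the
-- `k` variables has a type with the right value, and `μ` sends every fork to an admissible one.
record Image {n A} (S : Amalgam n A) (μ : Subst) (k : ℕ) : Set where
  open Amalgam S
  field
    idx   : Bits k → Fin N
    u-idx : ∀ û → u (idx û) ≡ bitsᵗ n μ û
    E-idx : ∀ û v̂ ŵ → E (idx û) (idx v̂) (bitsᶠ n μ û v̂ ŵ)

[]-cong : ∀ {σ τ : Subst} → (∀ p → σ p ≡ τ p) → ∀ A → A [ σ ] ≡ A [ τ ]
[]-cong e (var p)  = e p
[]-cong e ⊥'       = refl
[]-cong e (A ∧' B) = cong₂ _∧'_ ([]-cong e A) ([]-cong e B)
[]-cong e (A ∨' B) = cong₂ _∨'_ ([]-cong e A) ([]-cong e B)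
[]-cong e (A ⇒ B)  = cong₂ _⇒_ ([]-cong e A) ([]-cong e B)

maximal-above : ∀ x → ∃ λ y → Maximal y × x ≤C5 y ≡ true
maximal-above r = t , t-max , refl
maximal-above a = t , t-max , refl
maximal-above b = t , t-max , refl
maximal-above c = c , c-max , refl
maximal-above t = t , t-max , refl
maximal-above d = d , d-max , refl

ev-const : ∀ {k û} M x → (∀ y → x ≤C5 y ≡ true → Agree k (M y) û) →
  ∀ F → VarsBelow k F → ev M x F ≡ top û F
ev-const {k} {û} M r e F h = trans
  (root-local {M = M} {model û û û û û û} (λ
    { r → e r refl ; a → e a refl ; b → e b refl
    ; c → e c refl ; t → e t refl ; d → e d refl }) F h)
  (trans (root-const û û F) (fork-const û F))
ev-const M a e F h = trans (fork-local (e c refl) (e t refl) (e a refl) F h) (fork-const _ F)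
ev-const M b e F h = trans (fork-local (e t refl) (e d refl) (e b refl) F h) (fork-const _ F)
ev-const M c e F h = top-local (e c refl) F h
ev-const M t e F h = top-local (e t refl) F h
ev-const M d e F h = top-local (e d refl) F h

module Realise {n A} (S : Amalgam n A) (μ : Subst) (μ-unifies : InL (A [ μ ]))
  {k} (μ-below : ∀ p → p < n → VarsBelow k (μ p)) (I : Image S μ k) where
  open Amalgam S
  open Describe S
  open Image I

  exactly : Bits k → Fm
  exactly û = posᵇ var û ∧' (¬' negᵇ var û)

  Constant : Valuation → C5W → Bits k → Set
  Constant V x û = ∀ y → x ≤C5 y ≡ true → Agree k (modelOf V y) ⟦ û ⟧

  exactly-⊩ : ∀ V x û → V at x ⊩ exactly û ⇔ Constant V x û
  exactly-⊩ V x û = mk⇔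
    (λ (pos , ¬neg) y x≤y → posᵇ-negᵇ⇒Agree V y id û (⊩-mono V (posᵇ var û) x≤y pos) (¬neg y x≤y))
    (λ e → Agree⇒posᵇ V x id û (e x (≤-refl x)) , λ y x≤y → Agree⇒¬negᵇ V y id û (e y x≤y))

  -- Interprets the mark `i` as: all points above carry one and the same assignment, and its type is
  -- `i`. A point that sees two different assignments stays unmarked even if both have type `i`.
  G : Fin N → Fm
  G i = ⋁ᵇ k λ û → when (idx û Fin.≟ i) (exactly û)

  ν : Subst
  ν = glue N G μ

  ν-+ : ∀ p → ν (N + p) ≡ μ p
  ν-+ = glue-+ N G μ

  module _ (V : Valuation) where
    private
      V' = ν ⋆ V
      M  = modelOf V

    typeAt : C5W → Bits k
    typeAt x = bitsOf k (M x)

    typeAt-agree : ∀ x → Agree k (M x) ⟦ typeAt x ⟧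
    typeAt-agree x = Agree-sym (⟦bitsOf⟧ k (M x))

    constant-≡ : ∀ x û → Constant V x û → û ≡ typeAt x
    constant-≡ x û e = sym (trans (bitsOf-cong k (e x (≤-refl x))) (bitsOf-⟦⟧ û))

    q-⊩ : ∀ x i → V' at x ⊩ q i ⇔ (∃ λ û → idx û ≡ i × Constant V x û)
    q-⊩ x i = mk⇔
      (λ h → let û , l = to (⋁ᵇ-⊩ k _)
                   (subst (V at x ⊩_) (glue-toℕ N G μ i) (to (⋆-⊩ ν V (q i) x) h))
                 e , m = to (when-⊩ (idx û Fin.≟ i) (exactly û)) l
             in û , e , to (exactly-⊩ V x û) m)
      (λ (û , e , const) → from (⋆-⊩ ν V (q i) x) (subst (V at x ⊩_) (sym (glue-toℕ N G μ i))
        (from (⋁ᵇ-⊩ k _) (û , from (when-⊩ (idx û Fin.≟ i) (exactly û))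
          (e , from (exactly-⊩ V x û) const)))))

    q-maximal : ∀ {x} → Maximal x → V' at x ⊩ q (idx (typeAt x))
    q-maximal {x} m = from (q-⊩ x _)
      (typeAt x , refl , maximal-elim m (λ y → Agree k (M y) ⟦ typeAt x ⟧) (typeAt-agree x))

    shift-ev : ∀ x p → shift V' x p ≡ ev M x (μ p)
    shift-ev x p = cong (ev M x) (ν-+ p)

    bits-ev : ∀ x → bits V' x ≡ bitsOf n (ev M x ∘ μ)
    bits-ev x = bitsOf-cong n (λ p _ → shift-ev x p)

    some : ∀ x → ¬ (V' at x ⊩ (¬' ⋁ᶠ N q))
    some x h with maximal-above x
    ... | y , m , x≤y = h y x≤y (from (⋁ᶠ-⊩ N q) (_ , q-maximal m))

    unique : ∀ x i j → V' at x ⊩ q i → V' at x ⊩ q j → i ≡ j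
    unique x i j h l with to (q-⊩ x i) h | to (q-⊩ x j) l
    ... | û , refl , ce | v̂ , refl , cf =
      cong idx (trans (constant-≡ x û ce) (sym (constant-≡ x v̂ cf)))

    value : ∀ x i → V' at x ⊩ q i → Agree n (shift V' x) ⟦ u i ⟧
    value x i h with to (q-⊩ x i) h
    ... | û , refl , const = bitsOf-≡⇒Agree n (trans (bits-ev x)
      (trans (bitsOf-cong n (λ p l → ev-const M x const (μ p) (μ-below p l)))
        (trans (sym (u-idx û)) (sym (bitsOf-⟦⟧ (u (idx û)))))))

    A-forced : ∀ x → V' at x ⊩ (A [ ρ ])
    A-forced x = from (⋆-⊩ ν V (A [ ρ ]) x)
      (subst (V at x ⊩_) ([]-∘ ν ρ A) (subst (V at x ⊩_) (sym ([]-cong ν-+ A)) (μ-unifies V x)))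

    mkLocal : ∀ x → (∀ i j w → V' at x ⊩ prem i j w → E i j w ⊎ V' at x ⊩ ends i j) → Local V' x
    mkLocal x adm = record
      { some-q = some x ; q-uniq = unique x ; q-value = value x ; q-adm = adm
      ; A-holds = A-forced x }

    local-maximal : ∀ {x} → Maximal x → Local V' x
    local-maximal {x} m = mkLocal x (λ i j w h → inj₂ (maximal-prem m i j w h))

    local-fork : ∀ {x y z} → Fork x y z → Local V' x
    local-fork {x} {y} {z} f = mkLocal x (fork-adm f
      (local-maximal (fork-maxˡ f)) (local-maximal (fork-maxʳ f))
      (q-maximal (fork-maxˡ f)) (q-maximal (fork-maxʳ f))
      (subst (E (idx (typeAt y)) (idx (typeAt z)))
        (sym (trans (bits-ev x) (bitsOf-cong n λ p l → trans (ev-fork f M (μ p))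
          (fork-local (typeAt-agree y) (typeAt-agree z) (typeAt-agree x) (μ p) (μ-below p l)))))
        (E-idx (typeAt y) (typeAt z) (typeAt x))))

    local-above-root : ∀ y → y ≢ r → Local V' y
    local-above-root r h = ⊥-elim (h refl)
    local-above-root a h = local-fork fork-a
    local-above-root b h = local-fork fork-b
    local-above-root c h = local-maximal c-max
    local-above-root t h = local-maximal t-max
    local-above-root d h = local-maximal d-max

    -- Marked points have constant assignments above them, and the two constants coincide at `t`.
    -- Thus all points except the root agree, and the root is the bottom of a degenerate fork by
    -- `root-const`.
    collapse : ∀ i → V' at a ⊩ q i → V' at b ⊩ q i → E i i (bits V' r)
    collapse i ha hb with to (q-⊩ a i) ha | to (q-⊩ b i) hb
    ... | û , refl , ca | v̂ , _ , cb = subst (E (idx û) (idx û))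
      (sym (trans (bits-ev r) (bitsOf-cong n λ p l →
        trans (root-local {M = M} {model ⟦ û ⟧ ⟦ û ⟧ ⟦ û ⟧ ⟦ û ⟧ ⟦ û ⟧ ⟦ ŵ ⟧} agree
                (μ p) (μ-below p l))
              (root-const ⟦ û ⟧ ⟦ ŵ ⟧ (μ p)))))
      (E-idx û û ŵ)
      where
      ŵ = typeAt r
      v̂≡û : v̂ ≡ û
      v̂≡û = trans (constant-≡ t v̂ (maximal-elim t-max (λ y → Agree k (M y) ⟦ v̂ ⟧) (cb t refl)))
        (sym (constant-≡ t û (maximal-elim t-max (λ y → Agree k (M y) ⟦ û ⟧) (ca t refl))))
      cb' : Constant V b û
      cb' = subst (Constant V b) v̂≡û cb
      agree : ∀ x → Agree k (M x) (model ⟦ û ⟧ ⟦ û ⟧ ⟦ û ⟧ ⟦ û ⟧ ⟦ û ⟧ ⟦ ŵ ⟧ x)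
      agree r = typeAt-agree r
      agree a = ca a refl
      agree b = cb' b refl
      agree c = ca c refl
      agree t = ca t refl
      agree d = cb' d refl

    local : ∀ x → Local V' x
    local r = mkLocal r (root-adm local-above-root (λ i ha hb → inj₁ (collapse i ha hb)))
    local a = local-fork fork-a
    local b = local-fork fork-b
    local c = local-maximal c-max
    local t = local-maximal t-max
    local d = local-maximal d-max

-- The unifier of `A` given by a family.

module UnifierOf {n A} (S : Amalgam n A) (below : VarsBelow n A) where
  open Amalgam S
  open Describe S
  open Extend S below
  open Projective B αs

  ε : Subst
  ε = unifier extendable ∘ˢ ρ

  ε-unifies : Unifier A ε
  ε-unifies V x = subst (V at x ⊩_) (sym ([]-∘ (unifier extendable) ρ A))
    (let _ , _ , _ , _ , h = unifier-valid extendable V x in h)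

  -- `ν` makes `B` valid, so it absorbs the projective unifier and what remains on the shifted
  -- variables is `μ`. Projectivity holds at every variable, which covers also the `p` not below
  -- `n`.
  ε-≼ : ∀ μ → Unifier A μ → ∀ {k} → (∀ p → p < n → VarsBelow k (μ p)) → Image S μ k → ε ≼ μ
  ε-≼ μ μ-unifies μ-below I = ν , λ p V x →
    (λ y _ → to (same V y p)) , (λ y _ → from (same V y p))
    where
    open Realise S μ μ-unifies μ-below I
    same : ∀ V y p → V at y ⊩ (ε p [ ν ]) ⇔ V at y ⊩ μ p
    same V y p = mk⇔
      (λ h → subst (V at y ⊩_) (ν-+ p) (to (⋆-⊩ ν V (ρ p) y) (to proj (from (⋆-⊩ ν V (ε p) y) h))))
      (λ h → to (⋆-⊩ ν V (ε p) y)
        (from proj (from (⋆-⊩ ν V (ρ p) y) (subst (V at y ⊩_) (sym (ν-+ p)) h))))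
      where
      proj : (ν ⋆ V) at y ⊩ unifier extendable (N + p) ⇔ val (ν ⋆ V) (N + p) y ≡ true
      proj = unifier-projective extendable (ν ⋆ V) y (N + p)
        (Local⇒⊩B (ν ⋆ V) y (λ z _ → local V z))

-- Enumeration of families and the amalgamation test.

∃ᵇ? : ∀ {n} {P : Bits n → Set} → (∀ w → Dec (P w)) → Dec (∃ P)
∃ᵇ? {n} P? = map′ Any.satisfied (λ (w , h) → lose (∈-allBits w) h) (Any.any? P? (allBits n))

∀ᵇ? : ∀ {n} {P : Bits n → Set} → (∀ w → Dec (P w)) → Dec (∀ w → P w)
∀ᵇ? {n} P? = map′ (λ h w → All.lookup h (∈-allBits w)) (λ h → All.universal h (allBits n))
  (All.all? P? (allBits n))

⊑? : ∀ {m n} (v : Bits m) (w : Bits n) → Dec (⟦ v ⟧ ⊑ ⟦ w ⟧)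
⊑? []      w = yes (λ _ ())
⊑? (e ∷ v) w with ⊑head | ⊑tail w
  where
  ⊑head : Dec (e ≡ true → ⟦ w ⟧ 0 ≡ true)
  ⊑head = (e Bool.≟ true) →-dec (⟦ w ⟧ 0 Bool.≟ true)
  ⊑tail : ∀ {n} (w : Bits n) → Dec (∀ p → ⟦ v ⟧ p ≡ true → ⟦ w ⟧ (suc p) ≡ true)
  ⊑tail []      = ⊑? v []
  ⊑tail (_ ∷ w) = ⊑? v w
... | yes h | yes k = yes λ { zero → h ; (suc p) → k p }
... | no ¬h | _     = no λ h → ¬h (h 0)
... | yes _ | no ¬k = no λ h → ¬k (λ p → h (suc p))

bitsOf-⊑ : ∀ n {u v} → u ⊑ v → ⟦ bitsOf n u ⟧ ⊑ ⟦ bitsOf n v ⟧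
bitsOf-⊑ (suc n) h zero    = h zero
bitsOf-⊑ (suc n) h (suc p) = bitsOf-⊑ n (h ∘ suc) p

_≟ᵇ_ : ∀ {n} → DecidableEquality (Bits n)
_≟ᵇ_ = Vec.≡-dec Bool._≟_

subsets : ∀ {X : Set} → List X → List (List X)
subsets []       = [] ∷ []
subsets (x ∷ xs) = map (x ∷_) (subsets xs) ++ subsets xs

-- Sets of forks and families of types are formed by filtering fixed lists, so they are literally
-- members of `subsets`, without any quotient by order or repetition.
filter∈subsets : ∀ {X : Set} {P : X → Set} (P? : ∀ x → Dec (P x)) xs → filter P? xs ∈ subsets xs
filter∈subsets P? [] = here refl
filter∈subsets P? (x ∷ xs) with P? x
... | yes _ = ∈-++⁺ˡ (∈-map⁺ (x ∷_) (filter∈subsets P? xs))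
... | no _  = ∈-++⁺ʳ (map (x ∷_) (subsets xs)) (filter∈subsets P? xs)

Pairs : ℕ → Set
Pairs n = List (Bits n × Bits n)

-- (v , ws): the value v at a maximal point together with the pairs (v' , w) such that the point
-- lies on a fork with bottom value w and other end of value v'.

Code : ℕ → Set
Code n = Bits n × Pairs n

_≟ᵖ_ : ∀ {n} → DecidableEquality (Bits n × Bits n)
_≟ᵖ_ = Product.≡-dec _≟ᵇ_ _≟ᵇ_

_≟ᶜ_ : ∀ {n} → DecidableEquality (Code n)
_≟ᶜ_ = Product.≡-dec _≟ᵇ_ (List.≡-dec _≟ᵖ_)

allPairs : ∀ n → Pairs n
allPairs n = cartesianProduct (allBits n) (allBits n)

allCodes : ∀ n → List (Code n)
allCodes n = cartesianProduct (allBits n) (subsets (allPairs n))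

module Candidate (A : Fm) {n} (cs : List (Code n)) where

  N : ℕ
  N = length cs

  u : Fin N → Bits n
  u i = proj₁ (lookup cs i)

  -- Each type vouches for the fork knowing only the value of the other end. Asking it of both makes
  -- `E` symmetric, as the unordered ends in `prem` require.
  E : Fin N → Fin N → Bits n → Set
  E i j w = (u j , w) ∈ proj₂ (lookup cs i) × (u i , w) ∈ proj₂ (lookup cs j)

  E? : ∀ i j w → Dec (E i j w)
  E? i j w = ((u j , w) ∈? _) ×-dec ((u i , w) ∈? _)
    where open DecMembership _≟ᵖ_

  ForkExt : Fin N → Fin N → Bits n → Set
  ForkExt i j w = E i j w × ⟦ w ⟧ ⊑ ⟦ u i ⟧ × ⟦ w ⟧ ⊑ ⟦ u j ⟧ ×
    fork ⟦ u i ⟧ ⟦ u j ⟧ ⟦ w ⟧ A ≡ true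

  RootExt : Fin N → Fin N → Fin N → Bits n → Bits n → Bits n → Set
  RootExt i j k w w' z = ⟦ z ⟧ ⊑ ⟦ w ⟧ × ⟦ z ⟧ ⊑ ⟦ w' ⟧ ×
    root (model ⟦ u j ⟧ ⟦ u i ⟧ ⟦ u k ⟧ ⟦ w ⟧ ⟦ w' ⟧ ⟦ z ⟧) A ≡ true

  -- Only finitely many values are involved and no substitution is mentioned, so the condition is
  -- decidable.
  Amalgamates : Set
  Amalgamates = Σ (Fin N) (λ _ → ⊤) × (∀ i → E i i (u i)) × (∀ i j → ∃ (ForkExt i j)) ×
    (∀ i j k w w' → E i j w → E i k w' → ∃ (RootExt i j k w w'))

  amalgamates? : Dec Amalgamates
  amalgamates? = Fin.any? (λ _ → yes tt) ×-dec Fin.all? (λ i → E? i i (u i)) ×-dec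
    Fin.all? (λ i → Fin.all? λ j → ∃ᵇ? λ w → E? i j w ×-dec ⊑? w (u i) ×-dec ⊑? w (u j) ×-dec
      (_ Bool.≟ true)) ×-dec
    Fin.all? (λ i → Fin.all? λ j → Fin.all? λ k → ∀ᵇ? λ w → ∀ᵇ? λ w' →
      E? i j w →-dec (E? i k w' →-dec ∃ᵇ? λ z → ⊑? z w ×-dec ⊑? z w' ×-dec (_ Bool.≟ true)))

  amalgam : Amalgamates → Amalgam n A
  amalgam ((i₀ , _) , loop , forks , roots) = record
    { N = N ; u = u ; E = E ; E? = E? ; E-sym = λ (h , k) → k , h ; E-loop = loop
    ; i₀ = i₀ ; fork-ext = forks ; root-ext = roots }

-- The family realised by a unifier.

module Coding (A : Fm) {n} (below : VarsBelow n A) (μ : Subst) (μ-unifies : Unifier A μ) {k}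
  (cs : List (Code n)) (T : Bits k → Pairs n)
  (T-intro : ∀ û v̂ ŵ → (bitsᵗ n μ v̂ , bitsᶠ n μ û v̂ ŵ) ∈ T û)
  (T-elim : ∀ û {v w} → (v , w) ∈ T û →
    ∃ λ v̂ → ∃ λ ŵ → bitsᵗ n μ v̂ ≡ v × bitsᶠ n μ û v̂ ŵ ≡ w)
  (idx : Bits k → Fin (length cs))
  (lookup-idx : ∀ û → (bitsᵗ n μ û , T û) ≡ lookup cs (idx û))
  (rep : ∀ i → ∃ λ û → (bitsᵗ n μ û , T û) ≡ lookup cs i) where
  open Candidate A cs

  code : Bits k → Code n
  code û = bitsᵗ n μ û , T û

  bitsᶠ-comm : ∀ (û v̂ ŵ : Bits k) → bitsᶠ n μ û v̂ ŵ ≡ bitsᶠ n μ v̂ û ŵ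
  bitsᶠ-comm û v̂ ŵ = bitsOf-cong n (λ p _ → fork-comm ⟦ û ⟧ ⟦ v̂ ⟧ ⟦ ŵ ⟧ (μ p))

  E-codes : ∀ {i j} (û v̂ : Bits k) → code û ≡ lookup cs i → code v̂ ≡ lookup cs j →
    ∀ ŵ → E i j (bitsᶠ n μ û v̂ ŵ)
  E-codes {i} {j} û v̂ e f ŵ =
    edge û v̂ e f (T-intro û v̂ ŵ) ,
    edge v̂ û f e (subst (λ w → (bitsᵗ n μ û , w) ∈ T v̂) (bitsᶠ-comm v̂ û ŵ) (T-intro v̂ û ŵ))
    where
    edge : ∀ {i j w} (û v̂ : Bits k) → code û ≡ lookup cs i → code v̂ ≡ lookup cs j →
      (bitsᵗ n μ v̂ , w) ∈ T û → (u j , w) ∈ proj₂ (lookup cs i)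
    edge {w = w} û v̂ e f = subst id (cong₂ (λ cd cd' → (proj₁ cd' , w) ∈ proj₂ cd) e f)

  value : ∀ {f w} → bitsOf n f ≡ w → Agree n ⟦ w ⟧ f
  value {f} e = subst (λ w → Agree n ⟦ w ⟧ f) e (⟦bitsOf⟧ n f)

  loops : ∀ i → E i i (u i)
  loops i with rep i
  ... | û , e = subst (E i i)
    (trans (bitsOf-cong n (λ p _ → fork-const ⟦ û ⟧ (μ p))) (cong proj₁ e)) (E-codes û û e e û)

  bitsOf-⊑-≡ : ∀ {f g v w} → bitsOf n f ≡ v → bitsOf n g ≡ w → f ⊑ g → ⟦ v ⟧ ⊑ ⟦ w ⟧
  bitsOf-⊑-≡ refl refl h = bitsOf-⊑ n h

  forks : ∀ i j → ∃ (ForkExt i j)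
  forks i j with rep i | rep j
  -- Any assignment may stand at the bottom; `û` is a convenient choice.
  ... | û , e | v̂ , f = bitsᶠ n μ û v̂ û , E-codes û v̂ e f û ,
    bitsOf-⊑-≡ refl (cong proj₁ e) (λ p → proj₁ ∘ fork-persistent (μ p)) ,
    bitsOf-⊑-≡ refl (cong proj₁ f) (λ p → proj₂ ∘ fork-persistent (μ p)) ,
    trans (fork-local (value (cong proj₁ e)) (value (cong proj₁ f)) (value refl) A below)
      (trans (sym (fork-subst μ A))
        (InL⇒ev (A [ μ ]) μ-unifies (model ⟦ û ⟧ ⟦ v̂ ⟧ ⟦ û ⟧ ⟦ û ⟧ ⟦ û ⟧ ⟦ û ⟧) a))

  -- One representative `û` of type `i` realises both forks, since both are recorded in its code;
  -- they can thus be drawn with the same `t`. The other ends `v̂` and `v̂'` only have the values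
  -- `u j` and `u l`, perhaps not these types, which is enough at `c` and `d`.
  roots : ∀ i j l w w' → E i j w → E i l w' → ∃ (RootExt i j l w w')
  roots i j l w w' (ij , _) (il , _) with rep i
  ... | û , e with T-elim û (subst (λ cd → (u j , w) ∈ proj₂ cd) (sym e) ij)
                 | T-elim û (subst (λ cd → (u l , w') ∈ proj₂ cd) (sym e) il)
  ... | v̂ , ŵ , ej , ew | v̂' , ŵ' , el , ew' = z ,
    bitsOf-⊑-≡ refl ew₁ (λ p → proj₁ ∘ root-persistent (μ p)) ,
    bitsOf-⊑-≡ refl ew' (λ p → proj₂ ∘ root-persistent (μ p)) ,
    trans (root-local {M' = pull μ M} agree A below)
      (trans (sym (root-subst μ A)) (InL⇒ev (A [ μ ]) μ-unifies M r))
    where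
    -- The assignment at the root, the last argument, is arbitrary; the value there is whatever `μ`
    -- produces.
    M : Model
    M = model ⟦ v̂ ⟧ ⟦ û ⟧ ⟦ v̂' ⟧ ⟦ ŵ ⟧ ⟦ ŵ' ⟧ ⟦ ŵ ⟧
    z : Bits n
    z = bitsOf n (root M ∘ μ)
    ew₁ : bitsᶠ n μ v̂ û ŵ ≡ w
    ew₁ = trans (bitsᶠ-comm v̂ û ŵ) ew
    agree : ∀ x → Agree n (model ⟦ u j ⟧ ⟦ u i ⟧ ⟦ u l ⟧ ⟦ w ⟧ ⟦ w' ⟧ ⟦ z ⟧ x) (pull μ M x)
    agree r = value refl
    agree a = value ew₁
    agree b = value ew'
    agree c = value ej
    agree t = value (cong proj₁ e)
    agree d = value el

  amalgamates : Amalgamates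
  amalgamates = (idx (bitsOf k (λ _ → false)) , tt) , loops , forks , roots

  image : ∀ h → Image (amalgam h) μ k
  image h = record
    { idx   = idx
    ; u-idx = λ û → cong proj₁ (sym (lookup-idx û))
    ; E-idx = λ û v̂ ŵ → E-codes û v̂ (lookup-idx û) (lookup-idx v̂) ŵ }

module _ (n : ℕ) (μ : Subst) (k : ℕ) where

  -- Filtering one fixed list makes equal sets of forks equal as lists, so that codes can be
  -- compared by equality.
  neighbours : Bits k → Pairs n
  neighbours û = filter
    (λ (v , w) → ∃ᵇ? λ v̂ → ∃ᵇ? λ ŵ → (bitsᵗ n μ v̂ ≟ᵇ v) ×-dec (bitsᶠ n μ û v̂ ŵ ≟ᵇ w))
    (allPairs n)

  neighbours-intro : ∀ û v̂ ŵ → (bitsᵗ n μ v̂ , bitsᶠ n μ û v̂ ŵ) ∈ neighbours û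
  neighbours-intro û v̂ ŵ = ∈-filter⁺ _ (∈-cartesianProduct⁺ (∈-allBits _) (∈-allBits _))
    (v̂ , ŵ , refl , refl)

  neighbours-elim : ∀ û {v w} → (v , w) ∈ neighbours û →
    ∃ λ v̂ → ∃ λ ŵ → bitsᵗ n μ v̂ ≡ v × bitsᶠ n μ û v̂ ŵ ≡ w
  neighbours-elim û h = proj₂ (∈-filter⁻ _ {xs = allPairs n} h)

  codeOf : Bits k → Code n
  codeOf û = bitsᵗ n μ û , neighbours û

  realised? : ∀ cd → Dec (∃ λ û → codeOf û ≡ cd)
  realised? cd = ∃ᵇ? λ û → codeOf û ≟ᶜ cd

  codes : List (Code n)
  codes = filter realised? (allCodes n)

  codes∈ : codes ∈ subsets (allCodes n)
  codes∈ = filter∈subsets realised? (allCodes n)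

  codeOf∈ : ∀ û → codeOf û ∈ codes
  codeOf∈ û = ∈-filter⁺ realised?
    (∈-cartesianProduct⁺ (∈-allBits _) (filter∈subsets _ (allPairs n))) (û , refl)

  codes-realised : ∀ i → ∃ λ û → codeOf û ≡ lookup codes i
  codes-realised i = proj₂ (∈-filter⁻ realised? {xs = allCodes n} (∈-lookup i))

μ-bounded : ∀ (μ : Subst) n → ∃ λ k → ∀ p → p < n → VarsBelow k (μ p)
μ-bounded μ zero = 0 , λ _ ()
μ-bounded μ (suc n) with bounded (μ 0) | μ-bounded (μ ∘ suc) n
... | k , h | l , f = k ⊔ l , λ
  { zero    _       → varsBelow-mono (ℕ.m≤m⊔n k l) (μ 0) h
  ; (suc p) (s≤s e) → varsBelow-mono (ℕ.m≤n⊔m k l) (μ (suc p)) (f p e) }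

module _ (A : Fm) {n} (below : VarsBelow n A) where
  open Candidate A

  candidate-unifier : ∀ (cs : List (Code n)) → Amalgamates cs → Subst
  candidate-unifier cs h = UnifierOf.ε (amalgam cs h) below

  unifiers : List (List (Code n)) → List Subst
  unifiers [] = []
  unifiers (cs ∷ css) with amalgamates? cs
  ... | yes h = candidate-unifier cs h ∷ unifiers css
  ... | no _  = unifiers css

  unifiers-valid : ∀ css → All (Unifier A) (unifiers css)
  unifiers-valid [] = []
  unifiers-valid (cs ∷ css) with amalgamates? cs
  ... | yes h = UnifierOf.ε-unifies (amalgam cs h) below ∷ unifiers-valid css
  ... | no _  = unifiers-valid css

  -- The list contains the unifier built from the proof that `amalgamates?` returns, which may
  -- differ from the given one; hence `P` is demanded for all proofs.
  unifiers-∈ : ∀ {P : Subst → Set} {cs css} → cs ∈ css → Amalgamates cs →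
    (∀ h → P (candidate-unifier cs h)) → Any P (unifiers css)
  unifiers-∈ {cs = cs} (here refl) h f with amalgamates? cs
  ... | yes h' = here (f h')
  ... | no ¬h  = ⊥-elim (¬h h)
  unifiers-∈ {css = cs' ∷ _} (there i) h f with amalgamates? cs'
  ... | yes _ = there (unifiers-∈ i h f)
  ... | no _  = unifiers-∈ i h f

  finite-complete : Complete A (unifiers (subsets (allCodes n)))
  finite-complete = unifiers-valid (subsets (allCodes n)) , λ μ μ-unifies →
    -- `k` varies with `μ`, but the list of families searched depends on `n` alone.
    let k , μ-below = μ-bounded μ n
        open Coding A below μ μ-unifies (codes n μ k) (neighbours n μ k)
          (neighbours-intro n μ k) (neighbours-elim n μ k) (λ û → Any.index (codeOf∈ n μ k û))
          (λ û → lookup-index (codeOf∈ n μ k û)) (codes-realised n μ k)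
    in unifiers-∈ (codes∈ n μ k) amalgamates
         (λ h → UnifierOf.ε-≼ (amalgam (codes n μ k) h) below μ μ-unifies μ-below (image h))

-- A single most general unifier ε of x ∨ ¬x would specialise both to x ↦ ⊤ and to x ↦ ⊥, so
-- ε x would be true under one classical assignment and false under another; put the first at c
-- and the second at all other maximal points.

excludedMiddle : Fm
excludedMiddle = var 0 ∨' (¬' var 0)

InL⇒top-≡ : ∀ u F G → InL ((F ⇒ G) ∧' (G ⇒ F)) → top u F ≡ top u G
InL⇒top-≡ u F G h = ⇔→≡ (⊃-elim (proj₁ f,g)) (⊃-elim (proj₂ f,g))
  where f,g = &-elim (InL⇒ev _ h (λ _ → u) c)

not-unitary : ¬ Σ Subst (λ ε → Complete excludedMiddle (ε ∷ []))
not-unitary (ε , (ε-unifies ∷ []) , complete)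
  with complete (λ _ → ⊤') (λ V x → inj₁ (λ _ _ h → h))
     | complete (λ _ → ⊥') (λ V x → inj₂ (λ _ _ h → h))
... | here (α , α≡) | here (β , β≡) = absurd (∥-elim (InL⇒ev _ ε-unifies M r))
  where
  off v₁ v₀ : Assignment
  off _ = false
  v₁ = top off ∘ α
  v₀ = top off ∘ β
  ε-true : top v₁ (ε 0) ≡ true
  ε-true = trans (sym (top-subst α (ε 0))) (InL⇒top-≡ off _ ⊤' (α≡ 0))
  ε-false : top v₀ (ε 0) ≡ false
  ε-false = trans (sym (top-subst β (ε 0))) (InL⇒top-≡ off _ ⊥' (β≡ 0))
  M : Model
  M = model v₁ v₀ v₀ off off off
  absurd : ev M r (ε 0) ≡ true ⊎ ev M r (¬' ε 0) ≡ true → ⊥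
  absurd (inj₁ h) with trans (sym (ev-mono M (ε 0) {r} {t} refl h)) ε-false
  ... | ()
  absurd (inj₂ h) with ⊃-elim (ev-mono M (¬' ε 0) {r} {c} refl h) ε-true
  ... | ()

theorem4p10 : Unification.Finitary L-C5
theorem4p10 =
  (excludedMiddle , ((λ _ → ⊤') , λ V x → inj₁ (λ _ _ h → h)) , not-unitary) ,
  λ A _ → let n , below = bounded A in _ , finite-complete A below
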